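{- Let $\mathbf T$ be a countable homogeneous tournament with its fixed expansion $\mathbf T^*$ (described in the context), and let $n$ be a positive integer. Then the class $\mathrm{Age}(I_n[\mathbf T]^*)$ has the Ramsey property.
   Context: The countable homogeneous tournaments are $I_1$ (one vertex), the 3-cycle $C_3$ on $\{0,1,2\}$, $\mathbb Q$ (with $E(x,y)$ iff $x<y$), the dense local order $\mathbf S(2)$ (a countable dense subset $D$ of the unit circle with no antipodal points and not containing the points at angles $\pi/2,3\pi/2$, with $E(x,y)$ iff the counterclockwise angle from $x$ to $y$ is in $(0,\pi)$), and the generic tournament $T^\omega$. Fixed expansions $\mathbf T^*$, containing $E$ and a binary $<$ interpreted as a linear order $<^*$: $I_1^*$ adds one unary predicate true at its vertex; $C_3^*$ adds three unary predicates, the $i$-th true exactly at $i$, and a fixed linear order; $\mathbb Q^*$ adds the usual order; $\mathbf S(2)^*$ adds two unary predicates for the two halves of $D$ cut by the line through angles $\pi/2,3\pi/2$ and the order $x<y$ iff ($x,y$ in the same half and $E(x,y)$) or (different halves and $E(y,x)$); $T^{\omega*}$ is the Fraïssé limit of all finite linearly ordered tournaments. $I_n[\mathbf T]^*$ has universe $[n]\times T$ ($[n]=\{0,\dots,n-1\}$); for each relation $R$ of $\mathbf T^*$ other than $<$ (including $E$), of arity $m$, $R((k_1,x_1),\dots,(k_m,x_m))$ iff $k_1=\dots=k_m$ and $R^{\mathbf T^*}(x_1,\dots,x_m)$; $(i,x)<(j,y)$ iff $i<j$ or ($i=j$ and $x<^*y$); and unary predicates $P_i=\{i\}\times T$ for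 $i\in[n]$. The age of a structure is the class of finite structures embeddable in it. A class $\mathcal K$ of finite structures has the Ramsey property if for all $k\in\mathbb N$ and $\mathbf A,\mathbf B\in\mathcal K$ there is $\mathbf C\in\mathcal K$ such that for every colouring of the substructures of $\mathbf C$ isomorphic to $\mathbf A$ with $k$ colours there is a substructure $\mathbf B'\cong\mathbf B$ of $\mathbf C$ on whose substructures isomorphic to $\mathbf A$ the colouring is constant. -}

module Defs where

open import Level using (Level) renaming (suc to lsuc; zero to lzero)
open import Data.Nat as ℕ using (ℕ; zero; suc)
open import Data.Nat.Divisibility using (_∣_)
open import Data.Integer using (∣_∣)
open import Data.Fin as Fin using (Fin; zero; suc; toℕ)
open import Data.Fin.Subset using (Subset; _∈_; _⊆_)
open import Data.Rational as ℚ using (ℚ; 0ℚ; 1ℚ; ½; _+_; _-_; _<_; _≤_; _≤?_)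
open import Data.Product using (Σ; _×_; _,_; ∃)
open import Data.Sum using (_⊎_)
open import Data.Unit using (⊤; tt)
open import Data.Empty using (⊥)
open import Relation.Nullary using (¬_; yes; no)
open import Relation.Binary.PropositionalEquality using (_≡_; _≢_)

record Str (I : Set) : Set₁ where
  field
    Carrier : Set
    E       : Carrier → Carrier → Set
    Lt      : Carrier → Carrier → Set
    U       : I → Carrier → Set
open Str public

record FinStr (I : Set) : Set₁ where
  field
    size : ℕ
    FE   : Fin size → Fin size → Set
    FLt  : Fin size → Fin size → Set
    FU   : I → Fin size → Set
open FinStr public

toStr : {I : Set} → FinStr I → Str I
toStr A = record { Carrier = Fin (size A) ; E = FE A ; Lt = FLt A ; U = FU A }

_⇔_ : Set → Set → Set
P ⇔ Q = (P → Q) × (Q → P)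

record Emb {I : Set} (M N : Str I) : Set where
  field
    fun   : Carrier M → Carrier N
    inj   : ∀ x y → fun x ≡ fun y → x ≡ y
    presE : ∀ x y → E M x y ⇔ E N (fun x) (fun y)
    presL : ∀ x y → Lt M x y ⇔ Lt N (fun x) (fun y)
    presU : ∀ i x → U M i x ⇔ U N i (fun x)
open Emb public

Age : {I : Set} → Str I → FinStr I → Set
Age M A = Emb (toStr A) M

IsCopy : {I : Set} (A C : FinStr I) → Subset (size C) → Set
IsCopy A C S = Σ (Emb (toStr A) (toStr C)) λ f →
  ∀ j → (j ∈ S) ⇔ (∃ λ i → fun f i ≡ j)

RamseyProperty : {I : Set} → (FinStr I → Set) → Set₁
RamseyProperty {I} K =
  ∀ (k : ℕ) (A B : FinStr I) → K A → K B →
  Σ (FinStr I) λ C → K C ×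
    (∀ (χ : Subset (size C) → Fin k) →
      Σ (Subset (size C)) λ B' → IsCopy B C B' ×
        Σ (Fin k) λ col → ∀ S → IsCopy A C S → S ⊆ B' → χ S ≡ col)

In : {I : Set} (n : ℕ) → Str I → Str (I ⊎ Fin n)
In {I} n M = record
  { Carrier = Fin n × Carrier M
  ; E  = λ { (k , x) (l , y) → k ≡ l × E M x y }
  ; Lt = λ { (k , x) (l , y) → (k Fin.< l) ⊎ (k ≡ l × Lt M x y) }
  ; U  = λ { (Data.Sum.inj₁ i) (k , x) → U M i x
           ; (Data.Sum.inj₂ i) (k , x) → k ≡ i }
  }

I1Star : Str (Fin 1)
I1Star = record { Carrier = ⊤ ; E = λ _ _ → ⊥ ; Lt = λ _ _ → ⊥ ; U = λ _ _ → ⊤ }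

C3E : Fin 3 → Fin 3 → Set
C3E x y = toℕ y ≡ (suc (toℕ x)) ℕ.% 3

C3Star : Str (Fin 3)
C3Star = record { Carrier = Fin 3 ; E = C3E ; Lt = Fin._<_ ; U = λ i x → x ≡ i }

QStar : Str ⊥
QStar = record { Carrier = ℚ ; E = ℚ._<_ ; Lt = ℚ._<_ ; U = λ () }

-- S(2)^* : points of the unit circle at angle π·q, q ∈ [0,2) rational whose
-- reduced form has even numerator and odd denominator.  This D is countable,
-- dense, contains no antipodal pair and avoids the angles π/2, 3π/2.
2ℚ : ℚ
2ℚ = 1ℚ + 1ℚ

3/2 : ℚ
3/2 = 1ℚ + ½

InD : ℚ → Set
InD q = (0ℚ ≤ q) × (q < 2ℚ) × (2 ∣ ∣ ℚ.numerator q ∣) × ¬ (2 ∣ ℚ.denominatorℕ q)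

record DPt : Set where
  constructor pt
  field
    angle : ℚ
    .inD  : InD angle
open DPt public

-- counterclockwise angle (in units of π) from angle a to angle b, in [0,2)
ccw : ℚ → ℚ → ℚ
ccw a b with a ≤? b
... | yes _ = b - a
... | no  _ = (b - a) + 2ℚ

S2E : DPt → DPt → Set
S2E x y = (0ℚ < ccw (angle x) (angle y)) × (ccw (angle x) (angle y) < 1ℚ)

RightHalf LeftHalf : DPt → Set
RightHalf x = (angle x < ½) ⊎ (3/2 < angle x)
LeftHalf  x = (½ < angle x) × (angle x < 3/2)

S2Half : Fin 2 → DPt → Set
S2Half zero    = RightHalf
S2Half (suc _) = LeftHalf

SameHalf : DPt → DPt → Set
SameHalf x y = (RightHalf x × RightHalf y) ⊎ (LeftHalf x × LeftHalf y)

DiffHalf : DPt → DPt → Set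
DiffHalf x y = (RightHalf x × LeftHalf y) ⊎ (LeftHalf x × RightHalf y)

S2Star : Str (Fin 2)
S2Star = record
  { Carrier = DPt
  ; E  = S2E
  ; Lt = λ x y → (SameHalf x y × S2E x y) ⊎ (DiffHalf x y × S2E y x)
  ; U  = S2Half
  }

-- T^{ω*}: the Fraïssé limit of the class of finite linearly ordered tournaments,
-- i.e. a countable homogeneous structure whose age is exactly that class.
IsOrderedTournament : {I : Set} → Str I → Set
IsOrderedTournament M =
  (∀ x → ¬ E M x x) × (∀ x y → E M x y → ¬ E M y x) ×
  (∀ x y → x ≢ y → E M x y ⊎ E M y x) ×
  (∀ x → ¬ Lt M x x) × (∀ x y z → Lt M x y → Lt M y z → Lt M x z) ×
  (∀ x y → x ≢ y → Lt M x y ⊎ Lt M y x)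

Countable : Set → Set
Countable X = Σ (X → ℕ) λ f → ∀ x y → f x ≡ f y → x ≡ y

Homogeneous : {I : Set} → Str I → Set₁
Homogeneous {I} M =
  ∀ (A : FinStr I) (f g : Emb (toStr A) M) →
  Σ (Emb M M) λ σ → (∀ y → ∃ λ x → fun σ x ≡ y) × (∀ a → fun σ (fun f a) ≡ fun g a)

IsTωStar : Str ⊥ → Set₁
IsTωStar M = Countable (Carrier M) × Homogeneous M ×
  (∀ (A : FinStr ⊥) → Age M A ⇔ IsOrderedTournament (toStr A))

data HomTournamentExpansion : (I : Set) → Str I → Set₂ where
  isI1 : HomTournamentExpansion (Fin 1) I1Star
  isC3 : HomTournamentExpansion (Fin 3) C3Star
  isQ  : HomTournamentExpansion ⊥ QStar
  isS2 : HomTournamentExpansion (Fin 2) S2Star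
  isTω : (M : Str ⊥) → IsTωStar M → HomTournamentExpansion ⊥ M

{-# OPTIONS --safe #-}

-- The class of finite ordered graphs is Ramsey (Nešetřil–Rödl), by the partite construction:
-- Ramsey's theorem chooses the parts, and for each choice of parts the Hales–Jewett theorem
-- makes the copies of A over these parts monochromatic in a power of the previous system.
-- For ℚ, S(2) and the generic tournament, a finite structure in the age of I_n[T]* is an
-- ordered graph whose vertices are labelled by their unary predicates.  Labels come for free:
-- if C is a Ramsey witness for the ordered graphs underlying A and B, let C⁺ have one vertex for
-- each pair of a label and a vertex of C, and colour a copy of A in C by the colour of the copy
-- in C⁺ with the labels of A.  For I_1 and C_3 the unary predicates identify every vertex, so B
-- contains at most one copy of A.

module Submission where

open import Defs
open import Data.Nat using (ℕ; _≥_)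

-- A tournament with a linear order is an ordered graph: for x < y one bit tells whether E(x,y)
-- holds, and totality supplies E(y,x) otherwise. Between different blocks of I_n[T] E fails both
-- ways, but the block belongs to the label, so labels and bits together still recover E. In ℚ and
-- S(2) the order and the labels already decide E: after turning the left half of S(2) by π, x < y
-- compares rotated angles, and for x < y the relation E(x,y) says that x and y lie in the same
-- half. This is why a labelled tournament is asked to realise a graph only on pairs whose E agrees
-- with it.
--
-- The obstacle in the partite step is that copies are induced. A power in which edges are required
-- in all coordinates favours non-edges, and one in which a single coordinate suffices favours
-- edges. The choice is therefore made separately for each pair of parts, according to whether A has
-- an edge there, so that the constant coordinates of a line never influence the result.

-- The Hales-Jewett theorem, by Shelah's proof.

module HalesJewettTheorem where

  open import Data.Nat using (ℕ; zero; suc; _+_; _^_; z≤n; s≤s)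
  import Data.Nat.Properties as ℕₚ
  open import Data.Fin as Fin using (Fin; zero; suc; finToFun; funToFin; combine)
  import Data.Fin.Properties as Finₚ
  open import Data.Vec using (Vec; []; _∷_; map; lookup; tabulate; _++_)
  import Data.Vec.Properties as Vecₚ
  open import Data.Vec.Membership.Propositional using (_∈_)
  open import Data.Vec.Membership.Propositional.Properties using (∈-map⁺; ∈-++⁺ˡ; ∈-++⁺ʳ)
  open import Data.Vec.Relation.Unary.Any using (here; there; index)
  open import Data.Vec.Relation.Unary.Any.Properties using (lookup-index)
  open import Data.Maybe as Maybe using (Maybe; just; nothing; fromMaybe; maybe′)
  open import Data.Product using (Σ; _×_; _,_; proj₁; proj₂)
  open import Data.Sum as Sum using (_⊎_; inj₁; inj₂; [_,_]′)
  open import Function using (_∘_; id)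
  open import Relation.Binary.PropositionalEquality hiding ([_])
  open ≡-Reasoning

  private variable
    m n k t N : ℕ
    X : Set

  funToFin-cong : {f g : Fin m → Fin n} → (∀ i → f i ≡ g i) → funToFin f ≡ funToFin g
  funToFin-cong {zero}  eq = refl
  funToFin-cong {suc m} eq = cong₂ combine (eq zero) (funToFin-cong (eq ∘ suc))

  funToFin-injective : (f g : Fin m → Fin n) → funToFin f ≡ funToFin g → ∀ i → f i ≡ g i
  funToFin-injective f g eq i = begin
    f i                       ≡⟨ Finₚ.finToFun-funToFin f i ⟨
    finToFun (funToFin f) i   ≡⟨ cong (λ z → finToFun z i) eq ⟩
    finToFun (funToFin g) i   ≡⟨ Finₚ.finToFun-funToFin g i ⟩
    g i                       ∎

  -- The pigeonhole principle is to be applied to whole colourings, so each is coded as one of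
  -- `k ^ (t ^ N)` numbers. Without function extensionality equal codes yield pointwise equality
  -- only, which suffices.
  colouringCode : (Vec (Fin t) N → Fin k) → Fin (k ^ (t ^ N))
  colouringCode χ = funToFin (λ z → χ (tabulate (finToFun z)))

  colouringCode-injective : (χ χ′ : Vec (Fin t) N → Fin k) →
    colouringCode χ ≡ colouringCode χ′ → ∀ w → χ w ≡ χ′ w
  colouringCode-injective χ χ′ eq w = begin
    χ w    ≡⟨ cong χ decode ⟨
    χ _    ≡⟨ funToFin-injective _ _ eq (funToFin (lookup w)) ⟩
    χ′ _   ≡⟨ cong χ′ decode ⟩
    χ′ w   ∎
    where
    decode : tabulate (finToFun (funToFin (lookup w))) ≡ w
    decode = trans (Vecₚ.tabulate-cong (Finₚ.finToFun-funToFin (lookup w))) (Vecₚ.tabulate∘lookup w)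

  -- The entries `nothing` of a combinatorial line are its active coordinates.
  _⟨_⟩ : Vec (Maybe X) N → X → Vec X N
  L ⟨ c ⟩ = map (fromMaybe c) L

  HalesJewett : ℕ → ℕ → Set
  HalesJewett t k = Σ ℕ λ N → ∀ (χ : Vec (Fin t) N → Fin k) →
    Σ (Vec (Maybe (Fin t)) N) λ L → nothing ∈ L × Σ (Fin k) λ col → ∀ c → χ (L ⟨ c ⟩) ≡ col

  -- A word over `X ⊎ Fin m` in which every `inj₂ i` occurs is an m-dimensional combinatorial
  -- subspace: the coordinates `inj₂ i` move together with the i-th parameter.
  _[_] : Vec (X ⊎ Fin m) N → Vec X m → Vec X N
  S [ w ] = map [ id , lookup w ]′ S

  _[_]ᴸ : Vec (X ⊎ Fin m) N → Vec (Maybe X) m → Vec (Maybe X) N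
  S [ L ]ᴸ = map [ just , lookup L ]′ S

  []ᴸ-⟨⟩ : (S : Vec (X ⊎ Fin m) N) (L : Vec (Maybe X) m) (c : X) →
    (S [ L ]ᴸ) ⟨ c ⟩ ≡ S [ L ⟨ c ⟩ ]
  []ᴸ-⟨⟩ []           L c = refl
  []ᴸ-⟨⟩ (inj₁ a ∷ S) L c = cong (a ∷_) ([]ᴸ-⟨⟩ S L c)
  []ᴸ-⟨⟩ (inj₂ i ∷ S) L c = cong₂ _∷_ (sym (Vecₚ.lookup-map i (fromMaybe c) L)) ([]ᴸ-⟨⟩ S L c)

  []ᴸ-active : (S : Vec (X ⊎ Fin m) N) (L : Vec (Maybe X) m) →
    (∀ i → inj₂ i ∈ S) → nothing ∈ L → nothing ∈ S [ L ]ᴸ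
  []ᴸ-active S L all star =
    subst (_∈ S [ L ]ᴸ) (sym (lookup-index star)) (∈-map⁺ [ just , lookup L ]′ (all (index star)))

  -- Identifies the letters 0 and 1, so `map merge u ≡ map merge v` says that u and v differ only by
  -- exchanges of these two letters. Away from 0 it is the predecessor.
  merge : Fin (2 + t) → Fin (1 + t)
  merge zero    = zero
  merge (suc i) = i

  -- The word 0...01...1 with j zeros. There are n + 1 of them, one more than the pigeonholes in
  -- `shelah`.
  block : ∀ n → Fin (suc n) → Vec (Fin (2 + t)) n
  block zero    j       = []
  block (suc n) zero    = suc zero ∷ block n zero
  block (suc n) (suc j) = zero ∷ block n j

  -- The positions from i to j - 1, where `block n i` and `block n j` differ, are active; the letter
  -- 0 then gives `block n j` and the letter 1 gives `block n i`.
  blockLine : ∀ n {i j : Fin (suc n)} → i Fin.≤ j → Vec (Maybe (Fin (2 + t))) n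
  blockLine zero                      _       = []
  blockLine (suc n) {zero}  {zero}    _       = just (suc zero) ∷ blockLine n {zero} {zero} z≤n
  blockLine (suc n) {zero}  {suc j}   _       = nothing ∷ blockLine n {zero} {j} z≤n
  blockLine (suc n) {suc i} {suc j} (s≤s i≤j) = just zero ∷ blockLine n i≤j

  blockLine-⟨0⟩ : ∀ n {i j : Fin (suc n)} (i≤j : i Fin.≤ j) →
    blockLine {t} n i≤j ⟨ zero ⟩ ≡ block n j
  blockLine-⟨0⟩ zero                      _       = refl
  blockLine-⟨0⟩ (suc n) {zero}  {zero}    _       = cong (_ ∷_) (blockLine-⟨0⟩ n {zero} {zero} z≤n)
  blockLine-⟨0⟩ (suc n) {zero}  {suc j}   _       = cong (_ ∷_) (blockLine-⟨0⟩ n {zero} {j} z≤n)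
  blockLine-⟨0⟩ (suc n) {suc i} {suc j} (s≤s i≤j) = cong (_ ∷_) (blockLine-⟨0⟩ n i≤j)

  blockLine-⟨1⟩ : ∀ n {i j : Fin (suc n)} (i≤j : i Fin.≤ j) →
    blockLine {t} n i≤j ⟨ suc zero ⟩ ≡ block n i
  blockLine-⟨1⟩ zero                      _       = refl
  blockLine-⟨1⟩ (suc n) {zero}  {zero}    _       = cong (_ ∷_) (blockLine-⟨1⟩ n {zero} {zero} z≤n)
  blockLine-⟨1⟩ (suc n) {zero}  {suc j}   _       = cong (_ ∷_) (blockLine-⟨1⟩ n {zero} {j} z≤n)
  blockLine-⟨1⟩ (suc n) {suc i} {suc j} (s≤s i≤j) = cong (_ ∷_) (blockLine-⟨1⟩ n i≤j)

  blockLine-active : ∀ n {i j : Fin (suc n)} (i≤j : i Fin.≤ j) → i Fin.< j →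
    nothing ∈ blockLine {t} n i≤j
  blockLine-active zero    {zero}  {zero}  _         ()
  blockLine-active (suc n) {zero}  {suc j} _         _         = here refl
  blockLine-active (suc n) {suc i} {suc j} (s≤s i≤j) (s≤s i<j) = there (blockLine-active n i≤j i<j)

  -- Shelah's insensitivity lemma: in each block of coordinates the pigeonhole principle yields
  -- a line 0…0∗…∗1…1 whose values at 0 and 1 have the same colour.
  shelah : ∀ t m k → Σ ℕ λ N → ∀ (χ : Vec (Fin (2 + t)) N → Fin k) →
    Σ (Vec (Fin (2 + t) ⊎ Fin m) N) λ S → (∀ i → inj₂ i ∈ S) ×
      (∀ u v → map merge u ≡ map merge v → χ (S [ u ]) ≡ χ (S [ v ]))
  shelah t zero    k = 0 , λ χ → [] , (λ ()) , λ _ _ _ → refl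
  shelah t (suc m) k = n₀ + N₀ , space
    where
    -- The colour of a tail word is the tuple of its colours after each of the 2 + t points of the
    -- first line, hence this number of colours.
    rest = shelah t m (k ^ (2 + t))
    N₀ = proj₁ rest
    -- The number of colourings of the tail words: among the n₀ + 1 blocks two induce the same one.
    -- The tail length must therefore be fixed first.
    n₀ = k ^ ((2 + t) ^ N₀)
    space : ∀ (χ : Vec (Fin (2 + t)) (n₀ + N₀) → Fin k) →
      Σ (Vec (Fin (2 + t) ⊎ Fin (suc m)) (n₀ + N₀)) λ S → (∀ i → inj₂ i ∈ S) ×
        (∀ u v → map merge u ≡ map merge v → χ (S [ u ]) ≡ χ (S [ v ]))
    space χ
      with i , j , i<j , same ←
        Finₚ.pigeonhole (ℕₚ.n<1+n n₀) (λ j → colouringCode (λ w → χ (block n₀ j ++ w)))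
      with S , params , insens ←
        proj₂ rest (λ w → funToFin (λ c → χ (blockLine n₀ (ℕₚ.<⇒≤ i<j) ⟨ c ⟩ ++ w)))
      = S⁺ , params⁺ , insens⁺
      where
      L = blockLine n₀ (ℕₚ.<⇒≤ i<j)
      S⁺ = map (maybe′ inj₁ (inj₂ zero)) L ++ map (Sum.map₂ suc) S
      params⁺ : ∀ i → inj₂ i ∈ S⁺
      params⁺ zero    = ∈-++⁺ˡ (∈-map⁺ _ (blockLine-active n₀ (ℕₚ.<⇒≤ i<j) i<j))
      params⁺ (suc i) = ∈-++⁺ʳ (map (maybe′ inj₁ (inj₂ zero)) L) (∈-map⁺ _ (params i))
      apply : ∀ c w → S⁺ [ c ∷ w ] ≡ L ⟨ c ⟩ ++ S [ w ]
      apply c w = trans (Vecₚ.map-++ _ (map (maybe′ inj₁ (inj₂ zero)) L) _) (cong₂ _++_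
        (trans (sym (Vecₚ.map-∘ _ _ L)) (Vecₚ.map-cong (λ { (just _) → refl ; nothing → refl }) L))
        (trans (sym (Vecₚ.map-∘ _ _ S)) (Vecₚ.map-cong (λ { (inj₁ _) → refl ; (inj₂ _) → refl }) S)))
      swap : ∀ w → χ (L ⟨ zero ⟩ ++ w) ≡ χ (L ⟨ suc zero ⟩ ++ w)
      swap w = begin
        χ (L ⟨ zero ⟩ ++ w)      ≡⟨ cong (λ x → χ (x ++ w)) (blockLine-⟨0⟩ n₀ _) ⟩
        χ (block n₀ j ++ w)       ≡⟨ colouringCode-injective _ _ same w ⟨
        χ (block n₀ i ++ w)       ≡⟨ cong (λ x → χ (x ++ w)) (blockLine-⟨1⟩ n₀ _) ⟨
        χ (L ⟨ suc zero ⟩ ++ w)  ∎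
      first : ∀ c d w → merge c ≡ merge d → χ (L ⟨ c ⟩ ++ w) ≡ χ (L ⟨ d ⟩ ++ w)
      first zero    zero    w eq   = refl
      first zero    (suc d) w refl = swap w
      first (suc c) zero    w refl = sym (swap w)
      first (suc c) (suc d) w refl = refl
      slice : Vec _ m → Fin (2 + t) → Fin k
      slice w c = χ (L ⟨ c ⟩ ++ S [ w ])
      insens⁺ : ∀ u v → map merge u ≡ map merge v → χ (S⁺ [ u ]) ≡ χ (S⁺ [ v ])
      insens⁺ (c ∷ u) (d ∷ v) eq = begin
        χ (S⁺ [ c ∷ u ])        ≡⟨ cong χ (apply c u) ⟩
        χ (L ⟨ c ⟩ ++ S [ u ])  ≡⟨ funToFin-injective (slice u) (slice v) (insens u v (Vecₚ.∷-injectiveʳ eq)) c ⟩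
        χ (L ⟨ c ⟩ ++ S [ v ])  ≡⟨ first c d _ (Vecₚ.∷-injectiveˡ eq) ⟩
        χ (L ⟨ d ⟩ ++ S [ v ])  ≡⟨ cong χ (apply d v) ⟨
        χ (S⁺ [ d ∷ v ])        ∎

  -- Induction on the alphabet. A line of the insensitive subspace that is monochromatic over the
  -- letters other than 0 stays so at 0, because there 0 may be replaced by 1.
  halesJewett : ∀ t k → HalesJewett t (suc k)
  -- The empty alphabet does arise, when there is no copy of A over the given parts; the line still
  -- provides an embedding there.
  halesJewett 0             k = 1 , λ χ → nothing ∷ [] , here refl , zero , λ ()
  halesJewett 1             k = 1 , λ χ → nothing ∷ [] , here refl , χ (zero ∷ []) , λ { zero → refl }
  halesJewett (suc (suc t)) k
    with m , line ← halesJewett (suc t) k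
    with N , space ← shelah t m (suc k)
    = N , λ χ → mono χ (space χ)
    where
    mono : ∀ χ → _ → _
    mono χ (S , params , insens)
      with L , star , col , eq ← line (λ w → χ (S [ map suc w ]))
      = S [ L⁺ ]ᴸ , []ᴸ-active S L⁺ params (∈-map⁺ _ star) , col , λ c → trans (cong χ ([]ᴸ-⟨⟩ S L⁺ c)) (final c)
      where
      L⁺ = map (Maybe.map suc) L
      shift : ∀ c → L⁺ ⟨ suc c ⟩ ≡ map suc (L ⟨ c ⟩)
      shift c = trans (sym (Vecₚ.map-∘ _ _ L))
        (trans (Vecₚ.map-cong (λ { (just _) → refl ; nothing → refl }) L) (Vecₚ.map-∘ _ _ L))
      merged : map merge (L⁺ ⟨ zero ⟩) ≡ map merge (L⁺ ⟨ suc zero ⟩)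
      merged = begin
        map merge (L⁺ ⟨ zero ⟩)      ≡⟨ cong (map merge) (Vecₚ.map-∘ _ _ L) ⟨
        map merge (map _ L)          ≡⟨ Vecₚ.map-∘ _ _ L ⟨
        map _ L                      ≡⟨ Vecₚ.map-cong (λ { (just _) → refl ; nothing → refl }) L ⟩
        map _ L                      ≡⟨ Vecₚ.map-∘ _ _ L ⟩
        map merge (map _ L)          ≡⟨ cong (map merge) (Vecₚ.map-∘ _ _ L) ⟩
        map merge (L⁺ ⟨ suc zero ⟩)  ∎
      final : ∀ c → χ (S [ L⁺ ⟨ c ⟩ ]) ≡ col
      final (suc c) = trans (cong (λ w → χ (S [ w ])) (shift c)) (eq c)
      final zero    = trans (insens _ _ merged) (final (suc zero))

-- Ramsey's theorem for a-subsets.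

module RamseyTheorem where

  open import Data.Nat using (ℕ; zero; suc; _+_; _*_; _≤_; s≤s)
  import Data.Nat.Properties as ℕₚ
  open import Data.Fin as Fin using (Fin; zero; suc)
  import Data.Fin.Properties as Finₚ
  open import Data.List as List using (List; []; _∷_; length; filter; take; allFin)
  import Data.List.Properties as Listₚ
  open import Data.List.Membership.Propositional using () renaming (_∈_ to _∈ˡ_)
  open import Data.List.Membership.Propositional.Properties using (∈-lookup)
  open import Data.List.Relation.Unary.Any using (here; there)
  open import Data.List.Relation.Unary.All as All using (All; []; _∷_)
  import Data.List.Relation.Unary.All.Properties as Allₚ
  open import Data.List.Relation.Unary.AllPairs as AllPairs using (AllPairs; []; _∷_)
  import Data.List.Relation.Unary.AllPairs.Properties as AllPairsₚ
  open import Data.List.Relation.Binary.Sublist.Propositional using (_⊆_; []; _∷_; _∷ʳ_; ⊆-refl; ⊆-trans; minimum)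
  open import Data.List.Relation.Binary.Sublist.Propositional.Properties using (All-resp-⊆; map⁺; filter-⊆; take-⊆)
  open import Data.Vec as Vec using (Vec; []; _∷_; toList)
  open import Data.Product using (Σ; _×_; _,_; proj₁; proj₂)
  open import Relation.Nullary using (yes; no; ¬_; contradiction)
  open import Relation.Unary using (Decidable)
  open import Relation.Unary.Properties using (∁?)
  open import Function using (_∘_; id)
  open import Relation.Binary.PropositionalEquality
  open HalesJewettTheorem using (merge)

  private variable
    X C : Set
    a k b p : ℕ

  length-filter+∁ : {P : X → Set} (P? : Decidable P) (xs : List X) →
    length (filter P? xs) + length (filter (∁? P?) xs) ≡ length xs
  length-filter+∁ P? [] = refl
  length-filter+∁ P? (x ∷ xs) with P? x
  ... | yes _ = cong suc (length-filter+∁ P? xs)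
  ... | no  _ = trans (ℕₚ.+-suc _ _) (cong suc (length-filter+∁ P? xs))

  ∁-large : ∀ b {m} {P : X → Set} (P? : Decidable P) (xs : List X) →
    length (filter P? xs) ≤ b → b + m ≤ length xs → m ≤ length (filter (∁? P?) xs)
  ∁-large b {m} P? xs few b+m≤ = ℕₚ.+-cancelˡ-≤ b _ _ (begin
    b + m                                              ≤⟨ b+m≤ ⟩
    length xs                                          ≡⟨ length-filter+∁ P? xs ⟨
    length (filter P? xs) + length (filter (∁? P?) xs) ≤⟨ ℕₚ.+-monoˡ-≤ _ few ⟩
    b + length (filter (∁? P?) xs)                     ∎)
    where open ℕₚ.≤-Reasoning

  suc-merge : (i : Fin (suc (suc k))) → ¬ i ≡ zero → suc (merge i) ≡ i
  suc-merge zero    i≢0 = contradiction refl i≢0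
  suc-merge (suc i) _   = refl

  -- Either the colour 0 occurs b times, or deleting it costs fewer than b elements and `merge`
  -- renumbers the remaining colours.
  pigeonhole-list : ∀ k b (f : X → Fin (suc k)) (xs : List X) → suc k * b ≤ length xs →
    Σ (Fin (suc k)) λ c → Σ (List X) λ ys → ys ⊆ xs × length ys ≡ b × All (λ y → f y ≡ c) ys
  pigeonhole-list zero b f xs b≤ =
    zero , take b xs , take-⊆ b xs ,
    trans (Listₚ.length-take b xs) (ℕₚ.m≤n⇒m⊓n≡m (subst (_≤ length xs) (ℕₚ.+-identityʳ b) b≤)) ,
    All.universal (λ y → only (f y)) _
    where
    only : (i : Fin 1) → i ≡ zero
    only zero = refl
  pigeonhole-list (suc k) b f xs b≤ with b ℕₚ.≤? length (filter ((Finₚ._≟ zero) ∘ f) xs)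
  ... | yes enough =
    zero , take b ys , ⊆-trans (take-⊆ b ys) (filter-⊆ _ xs) ,
    trans (Listₚ.length-take b ys) (ℕₚ.m≤n⇒m⊓n≡m enough) , Allₚ.take⁺ b (Allₚ.all-filter _ xs)
    where ys = filter ((Finₚ._≟ zero) ∘ f) xs
  ... | no few
    with c , zs , zs⊆ , len , same ←
      pigeonhole-list k b (merge ∘ f) (filter (∁? ((Finₚ._≟ zero) ∘ f)) xs)
        (∁-large b _ xs (ℕₚ.<⇒≤ (ℕₚ.≰⇒> few)) b≤)
    = suc c , zs , ⊆-trans zs⊆ (filter-⊆ _ xs) , len ,
      All.zipWith (λ { (nz , eq) → trans (sym (suc-merge _ nz)) (cong suc eq) })
        (All-resp-⊆ zs⊆ (Allₚ.all-filter _ xs) , same)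

  -- The a-subsets of ys are encoded as its sublists of length a, so that X needs neither an order
  -- nor decidable equality.
  HomogeneousFor : (Vec X a → C) → List X → C → Set
  HomogeneousFor {X} {a} χ ys col = ∀ (zs : Vec X a) → toList zs ⊆ ys → χ zs ≡ col

  -- Each element comes with the common colour of the tuples starting with it.
  data EndHomogeneous {X C : Set} {a : ℕ} (χ : Vec X (suc a) → C) : List (X × C) → Set where
    []  : EndHomogeneous χ []
    _∷_ : ∀ {y c ps} → HomogeneousFor (λ zs → χ (y ∷ zs)) (List.map proj₁ ps) c →
          EndHomogeneous χ ps → EndHomogeneous χ ((y , c) ∷ ps)

  -- In an end-homogeneous list the colour of a tuple is the one recorded at its first element, so
  -- elements with the same record form a homogeneous list.
  endHomogeneous⇒homogeneous : (χ : Vec X (suc a) → C) {ps qs : List (X × C)} {c : C} →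
    EndHomogeneous χ ps → qs ⊆ ps → All (λ q → proj₂ q ≡ c) qs → HomogeneousFor χ (List.map proj₁ qs) c
  endHomogeneous⇒homogeneous χ (h ∷ e) (_ ∷ʳ qs⊆)   eqs          zs       zs⊆          =
    endHomogeneous⇒homogeneous χ e qs⊆ eqs zs zs⊆
  endHomogeneous⇒homogeneous χ (h ∷ e) (refl ∷ qs⊆) (eq ∷ eqs)   (z ∷ zs) (_ ∷ʳ zs⊆)   =
    endHomogeneous⇒homogeneous χ e qs⊆ eqs (z ∷ zs) zs⊆
  endHomogeneous⇒homogeneous χ (h ∷ e) (refl ∷ qs⊆) (refl ∷ eqs) (z ∷ zs) (refl ∷ zs⊆) =
    h zs (⊆-trans zs⊆ (map⁺ proj₁ qs⊆))
  endHomogeneous⇒homogeneous χ []      []           []           (z ∷ zs) ()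

  RamseyNumber : ℕ → ℕ → ℕ → Set₁
  RamseyNumber k a b = Σ ℕ λ p → ∀ {X : Set} (xs : List X) → length xs ≡ p → (χ : Vec X a → Fin (suc k)) →
    Σ (List X) λ ys → ys ⊆ xs × length ys ≡ b × Σ (Fin (suc k)) (HomogeneousFor χ ys)

  -- Greedy choice: the head x is kept, and the tail is thinned to a list homogeneous for
  -- `χ (x ∷ _)` that is long enough for the remaining m steps.
  endHomogeneousNumber : (∀ b → RamseyNumber k a b) → ∀ m → Σ ℕ λ p → ∀ {X : Set} (xs : List X) →
    length xs ≡ p → (χ : Vec X (suc a) → Fin (suc k)) →
    Σ (List (X × Fin (suc k))) λ ps → List.map proj₁ ps ⊆ xs × length ps ≡ m × EndHomogeneous χ ps
  endHomogeneousNumber R zero    = 0 , λ xs _ χ → [] , minimum xs , refl , []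
  endHomogeneousNumber {k} {a} R (suc m) = suc (proj₁ (R p₀)) , build
    where
    p₀ = proj₁ (endHomogeneousNumber R m)
    build : ∀ {X : Set} (xs : List X) → length xs ≡ suc (proj₁ (R p₀)) → (χ : Vec X (suc a) → Fin (suc k)) →
      Σ (List (X × Fin (suc k))) λ ps → List.map proj₁ ps ⊆ xs × length ps ≡ suc m × EndHomogeneous χ ps
    build (x ∷ xs) len χ
      with ys , ys⊆ , len-ys , c , hom ← proj₂ (R p₀) xs (ℕₚ.suc-injective len) (λ zs → χ (x ∷ zs))
      with ps , ps⊆ , len-ps , end ← proj₂ (endHomogeneousNumber R m) ys len-ys χ
      = (x , c) ∷ ps , refl ∷ ⊆-trans ps⊆ ys⊆ , cong suc len-ps , (λ zs zs⊆ → hom zs (⊆-trans zs⊆ ps⊆)) ∷ end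

  -- Induction on the arity: end-homogeneity reduces the colour of a tuple to that of its first
  -- element, and `suc k * b` elements suffice for b of them to share it.
  ramseyNumber : ∀ k a b → RamseyNumber k a b
  ramseyNumber k zero    b = b , λ xs len χ → xs , ⊆-refl , len , χ [] , λ { [] _ → refl }
  ramseyNumber k (suc a) b
    with p , build ← endHomogeneousNumber (ramseyNumber k a) (suc k * b) = p , λ xs len χ → select χ (build xs len χ)
    where
    select : ∀ {X : Set} {xs : List X} (χ : Vec X (suc a) → Fin (suc k)) →
      (Σ (List (X × Fin (suc k))) λ ps → List.map proj₁ ps ⊆ xs × length ps ≡ suc k * b × EndHomogeneous χ ps) →
      Σ (List X) λ ys → ys ⊆ xs × length ys ≡ b × Σ (Fin (suc k)) (HomogeneousFor χ ys)
    select χ (ps , ps⊆ , len , end)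
      with c , qs , qs⊆ , len-qs , same ← pigeonhole-list k b proj₂ ps (ℕₚ.≤-reflexive (sym len))
      = List.map proj₁ qs , ⊆-trans (map⁺ proj₁ qs⊆) ps⊆ , trans (Listₚ.length-map proj₁ qs) len-qs ,
        c , endHomogeneous⇒homogeneous χ end qs⊆ same

  Increasing : (Fin a → Fin b) → Set
  Increasing f = ∀ {i j} → i Fin.< j → f i Fin.< f j

  sorted⇒⊆ : {zs ys : List (Fin p)} → AllPairs Fin._<_ zs → AllPairs Fin._<_ ys → All (_∈ˡ ys) zs → zs ⊆ ys
  sorted⇒⊆ {zs = []}     {ys}     _            _            _           = minimum ys
  sorted⇒⊆ {zs = z ∷ zs} {[]}     _            _            (() ∷ _)
  sorted⇒⊆ {zs = z ∷ zs} {y ∷ ys} (z< ∷ zs<)   (y< ∷ ys<)   (z∈ ∷ zs∈) with z∈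
  ... | here refl = refl ∷ sorted⇒⊆ zs< ys< (All.zipWith above (z< , zs∈))
    where
    above : ∀ {x} → z Fin.< x × x ∈ˡ (z ∷ ys) → x ∈ˡ ys
    above (z<z , here refl) = contradiction z<z (ℕₚ.<-irrefl refl)
    above (_   , there x∈)  = x∈
  ... | there z∈ys = y ∷ʳ sorted⇒⊆ (z< ∷ zs<) ys< (z∈ys ∷ All.zipWith above (z< , zs∈))
    where
    above : ∀ {x} → z Fin.< x × x ∈ˡ (y ∷ ys) → x ∈ˡ ys
    above (z<y , here refl) = contradiction (ℕₚ.<-trans z<y (All.lookup y< z∈ys)) (ℕₚ.<-irrefl refl)
    above (_   , there x∈)  = x∈

  AllPairs-resp-⊆ : {R : X → X → Set} {xs ys : List X} → xs ⊆ ys → AllPairs R ys → AllPairs R xs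
  AllPairs-resp-⊆ []            []        = []
  AllPairs-resp-⊆ (_ ∷ʳ xs⊆)    (_ ∷ rs)  = AllPairs-resp-⊆ xs⊆ rs
  AllPairs-resp-⊆ (refl ∷ xs⊆)  (r ∷ rs)  = All-resp-⊆ xs⊆ r ∷ AllPairs-resp-⊆ xs⊆ rs

  lookup-AllPairs : {R : X → X → Set} {xs : List X} → AllPairs R xs →
    ∀ {i j} → i Fin.< j → R (List.lookup xs i) (List.lookup xs j)
  lookup-AllPairs {xs = x ∷ xs} (r ∷ rs) {zero}  {suc j} _         = All.lookup r (∈-lookup j)
  lookup-AllPairs {xs = x ∷ xs} (r ∷ rs) {suc i} {suc j} (s≤s i<j) = lookup-AllPairs rs i<j

  toList-tabulate : ∀ {n} (f : Fin n → X) → toList (Vec.tabulate f) ≡ List.tabulate f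
  toList-tabulate {n = zero}  f = refl
  toList-tabulate {n = suc n} f = cong (f zero ∷_) (toList-tabulate (f ∘ suc))

  -- The form used to choose parts: κ selects b of p parts, and the a-subsets of the selection are
  -- the maps `κ ∘ u`.
  ramsey : ∀ k a b → Σ ℕ λ p → ∀ (χ : Vec (Fin p) a → Fin (suc k)) →
    Σ (Fin b → Fin p) λ κ → Increasing κ × Σ (Fin (suc k)) λ col →
      ∀ (u : Fin a → Fin b) → Increasing u → χ (Vec.tabulate (κ ∘ u)) ≡ col
  ramsey k a b with p , R ← ramseyNumber k a b = p , λ χ → convert χ (R (allFin p) (Listₚ.length-tabulate id) χ)
    where
    convert : ∀ {p} (χ : Vec (Fin p) a → Fin (suc k)) →
      (Σ (List (Fin p)) λ ys → ys ⊆ allFin p × length ys ≡ b × Σ (Fin (suc k)) (HomogeneousFor χ ys)) →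
      Σ (Fin b → Fin p) λ κ → Increasing κ × Σ (Fin (suc k)) λ col →
        ∀ (u : Fin a → Fin b) → Increasing u → χ (Vec.tabulate (κ ∘ u)) ≡ col
    convert χ (ys , ys⊆ , refl , c , hom) = List.lookup ys , lookup-AllPairs sorted , c , λ u inc →
      hom _ (subst (_⊆ ys) (sym (toList-tabulate _))
        (sorted⇒⊆ (AllPairsₚ.tabulate⁺-< (λ i<j → lookup-AllPairs sorted (inc i<j))) sorted
          (Allₚ.tabulate⁺ (λ i → ∈-lookup (u i)))))
      where
      sorted : AllPairs Fin._<_ ys
      sorted = AllPairs-resp-⊆ ys⊆ (AllPairsₚ.tabulate⁺-< id)

-- The Ramsey theorem for finite ordered graphs.

module OrderedGraphs where

  open import Data.Bool using (Bool; true; false)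
  import Data.Bool.Properties as Boolₚ
  open import Data.Nat using (ℕ; zero; suc; _*_; _^_)
  import Data.Nat.Properties as ℕₚ
  open import Data.Fin as Fin using (Fin; zero; suc; finToFun; funToFin; combine; remQuot)
  import Data.Fin.Properties as Finₚ
  open import Data.List as List using (List; []; _∷_; length; filter; allFin)
  open import Data.List.Membership.Propositional using () renaming (_∈_ to _∈ˡ_)
  open import Data.List.Membership.Propositional.Properties using (∈-lookup; ∈-filter⁺; ∈-allFin; ∈-map⁺)
  open import Data.List.Relation.Unary.Any as Any using (here; there)
  import Data.List.Relation.Unary.Any.Properties as Anyₚ
  open import Data.List.Relation.Unary.All as All using (All; []; _∷_)
  import Data.List.Relation.Unary.All.Properties as Allₚ
  open import Data.Vec as Vec using (Vec; tabulate; lookup)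
  import Data.Vec.Properties as Vecₚ
  open import Data.Vec.Membership.Propositional using (_∈_)
  import Data.Vec.Relation.Unary.Any as VAny
  import Data.Vec.Relation.Unary.Any.Properties as VAnyₚ
  open import Data.Maybe using (Maybe; just; nothing; fromMaybe)
  open import Data.Product using (Σ; _×_; _,_; proj₁; proj₂; ∃; uncurry)
  open import Data.Sum using (_⊎_; inj₁; inj₂; reduce)
  open import Relation.Nullary using (Dec; does; yes; no; contradiction; _→-dec_)
  open import Relation.Nullary.Decidable using (dec-true; dec-false)
  open import Function.Definitions using (Injective)
  open import Function using (_∘_)
  open import Relation.Binary.PropositionalEquality
  open import Relation.Binary using (tri<; tri≈; tri>)
  open HalesJewettTheorem
  open RamseyTheorem
  open ≡-Reasoning

  private variable
    a b p w N k : ℕ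

  -- No symmetry is imposed: embeddings and copies compare values only at pairs in increasing order,
  -- of vertices or of parts.
  Graph : Set → Set
  Graph V = V → V → Bool

  preimage? : (ι : Fin a → Fin p) (j : Fin p) → Dec (∃ λ i → ι i ≡ j)
  preimage? ι j = Finₚ.any? (λ i → ι i Finₚ.≟ j)

  -- Pairs of vertices not both in the image of ι are non-edges.
  pushforward : (Fin a → Fin p) → Graph (Fin a) → Graph (Fin p)
  pushforward ι A j j′ with preimage? ι j | preimage? ι j′
  ... | yes (i , _) | yes (i′ , _) = A i i′
  ... | yes _       | no _         = false
  ... | no _        | _            = false

  pushforward-image : {ι : Fin a → Fin p} (A : Graph (Fin a)) → Injective _≡_ _≡_ ι →
    ∀ i i′ → pushforward ι A (ι i) (ι i′) ≡ A i i′
  pushforward-image {ι = ι} A inj i i′ with preimage? ι (ι i) | preimage? ι (ι i′)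
  ... | yes (_ , eq) | yes (_ , eq′) = cong₂ A (inj eq) (inj eq′)
  ... | yes _        | no ∄          = contradiction (i′ , refl) ∄
  ... | no ∄         | _             = contradiction (i , refl) ∄

  quantify : Bool → (Fin N → Bool) → Bool
  quantify true  f = does (Finₚ.all? (λ n → f n Boolₚ.≟ true))
  quantify false f = does (Finₚ.any? (λ n → f n Boolₚ.≟ true))

  -- The constant value μ is neutral for the quantifier, so the value β of the other coordinates decides.
  quantify-neutral : ∀ μ {β} {f : Fin N → Bool} n₀ → f n₀ ≡ β → (∀ n → f n ≡ β ⊎ f n ≡ μ) → quantify μ f ≡ β
  quantify-neutral true  {true}  n₀ f≡β split = dec-true (Finₚ.all? _) (λ n → reduce (split n))
  quantify-neutral true  {false} n₀ f≡β split =
    dec-false (Finₚ.all? _) (λ all → contradiction (trans (sym (all n₀)) f≡β) λ ())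
  quantify-neutral false {true}  n₀ f≡β split = dec-true (Finₚ.any? _) (n₀ , f≡β)
  quantify-neutral false {false} n₀ f≡β split =
    dec-false (Finₚ.any? _) λ { (n , f≡true) → contradiction (trans (sym f≡true) (reduce (split n))) λ () }

  -- A partite system with p parts has vertex set Fin p × Fin w, the first component being the part.
  Partite : ℕ → ℕ → Set
  Partite p w = Graph (Fin p × Fin w)

  CopyOver : (Fin a → Fin p) → Graph (Fin a) → Partite p w → (Fin a → Fin w) → Set
  CopyOver ι A e s = ∀ i i′ → ι i Fin.< ι i′ → e (ι i , s i) (ι i′ , s i′) ≡ A i i′

  PartiteEmb : ∀ {w′} → Partite p w → Partite p w′ → (Fin p → Fin w → Fin w′) → Set
  PartiteEmb e e′ g = ∀ j v j′ v′ → j Fin.< j′ → e′ (j , g j v) (j′ , g j′ v′) ≡ e (j , v) (j′ , v′)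

  -- The partite lemma, for the copies of A over one choice ι of parts.

  module PartiteLemma {a p w} (k : ℕ) (A : Graph (Fin a)) (ι : Fin a → Fin p) (e : Partite p w) where

    copyOver? : ∀ s → Dec (CopyOver ι A e s)
    copyOver? s = Finₚ.all? λ i → Finₚ.all? λ i′ → (ι i Finₚ.<? ι i′) →-dec (_ Boolₚ.≟ _)

    -- The alphabet for Hales-Jewett: its letters are the copies of A over ι, found among the codes
    -- of all choices of one vertex per part.
    copies : List (Fin (w ^ a))
    copies = filter (copyOver? ∘ finToFun) (allFin (w ^ a))

    letter : Fin (length copies) → Fin a → Fin w
    letter c = finToFun (List.lookup copies c)

    letter-copy : ∀ c → CopyOver ι A e (letter c)
    letter-copy c = All.lookup (Allₚ.all-filter (copyOver? ∘ finToFun) (allFin (w ^ a))) (∈-lookup c)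

    copy-letter : ∀ s → CopyOver ι A e s → ∃ λ c → ∀ i → letter c i ≡ s i
    copy-letter s copy = Any.index s∈ , λ i → trans
      (cong (λ z → finToFun z i) (sym (Anyₚ.lookup-index s∈))) (Finₚ.finToFun-funToFin s i)
      where
      s∈ : funToFin s ∈ˡ copies
      s∈ = ∈-filter⁺ (copyOver? ∘ finToFun) (∈-allFin (funToFin s)) λ i i′ lt → trans
        (cong₂ (λ x y → e (ι i , x) (ι i′ , y)) (Finₚ.finToFun-funToFin s i) (Finₚ.finToFun-funToFin s i′))
        (copy i i′ lt)

    HJ = halesJewett (length copies) k
    dim = proj₁ HJ

    -- A vertex of the power has dim coordinates, each of which is either a vertex or undefined (zero).
    w⁺ : ℕ
    w⁺ = suc w ^ dim

    -- The value at undefined vertices agrees with that of `pushforward` at parts outside the image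
    -- of ι.
    coordEdge : Fin p → Fin (suc w) → Fin p → Fin (suc w) → Bool
    coordEdge j zero    j′ _        = false
    coordEdge j (suc v) j′ zero     = false
    coordEdge j (suc v) j′ (suc v′) = e (j , v) (j′ , v′)

    -- An edge of the power must be one in all coordinates over an edge of A, and in some coordinate
    -- elsewhere. Either way a coordinate with the value prescribed by A is neutral.
    e⁺ : Partite p w⁺
    e⁺ (j , x) (j′ , x′) =
      quantify {dim} (pushforward ι A j j′) (λ n → coordEdge j (finToFun x n) j′ (finToFun x′ n))

    -- An active coordinate keeps v. A constant coordinate c moves every vertex of the part ι i to
    -- the vertex of the copy c in that part; in other parts the copy has no vertex to offer.
    coord : Maybe (Fin (length copies)) → Fin p → Fin w → Fin (suc w)
    coord nothing  j v = suc v
    coord (just c) j v with preimage? ι j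
    ... | yes (i , _) = suc (letter c i)
    ... | no _        = zero

    coordEdge-const : ∀ c j v j′ v′ → j Fin.< j′ →
      coordEdge j (coord (just c) j v) j′ (coord (just c) j′ v′) ≡ pushforward ι A j j′
    coordEdge-const c j v j′ v′ j<j′ with preimage? ι j | preimage? ι j′
    ... | yes (i , refl) | yes (i′ , refl) = letter-copy c i i′ j<j′
    ... | yes _          | no _            = refl
    ... | no _           | _               = refl

    coord-const : ∀ c i v → Injective _≡_ _≡_ ι → coord (just c) (ι i) v ≡ suc (letter c i)
    coord-const c i v inj with preimage? ι (ι i)
    ... | yes (i′ , eq) = cong (suc ∘ letter c) (inj eq)
    ... | no ∄          = contradiction (i , refl) ∄

    alongLine : Vec (Maybe (Fin (length copies))) dim → Fin p → Fin w → Fin w⁺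
    alongLine L j v = funToFin (λ n → coord (lookup L n) j v)

    -- Some coordinate is active and reproduces e; the constant ones show two vertices of a copy of
    -- A, or undefined ones, and thus have the neutral value.
    alongLine-emb : ∀ L → nothing ∈ L → PartiteEmb e e⁺ (alongLine L)
    alongLine-emb L star j v j′ v′ j<j′ =
      quantify-neutral (pushforward ι A j j′) (VAny.index star) active coordinate
      where
      edge = λ x → coordEdge j (coord x j v) j′ (coord x j′ v′)
      decode : ∀ n → coordEdge j (finToFun (alongLine L j v) n) j′ (finToFun (alongLine L j′ v′) n)
        ≡ edge (lookup L n)
      decode n = cong₂ (λ x y → coordEdge j x j′ y) (Finₚ.finToFun-funToFin _ n) (Finₚ.finToFun-funToFin _ n)
      active : _ ≡ e (j , v) (j′ , v′)
      active = trans (decode (VAny.index star)) (cong edge (sym (VAnyₚ.lookup-index star)))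
      coordinate : ∀ n → _ ≡ e (j , v) (j′ , v′) ⊎ _ ≡ pushforward ι A j j′
      coordinate n with lookup L n | decode n
      ... | nothing | eq = inj₁ eq
      ... | just c  | eq = inj₂ (trans eq (coordEdge-const c j v j′ v′ j<j′))

    point : Vec (Fin (length copies)) dim → Fin a → Fin w⁺
    point h i = funToFin (λ n → suc (letter (lookup h n) i))

    -- Points of the line correspond to images of copies: the letter c yields the image of the copy
    -- c. Hence a monochromatic line is an embedded system whose copies of A over ι share one
    -- colour.
    alongLine-point : ∀ L c (s : Fin a → Fin w) → Injective _≡_ _≡_ ι → (∀ i → letter c i ≡ s i) →
      ∀ i → alongLine L (ι i) (s i) ≡ point (L ⟨ c ⟩) i
    alongLine-point L c s inj eq i = funToFin-cong λ n →
      trans (coordinate (lookup L n)) (cong (λ x → suc (letter x i)) (sym (Vecₚ.lookup-map n (fromMaybe c) L)))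
      where
      coordinate : ∀ x → coord x (ι i) (s i) ≡ suc (letter (fromMaybe c x) i)
      coordinate nothing   = cong suc (sym (eq i))
      coordinate (just c′) = coord-const c′ i (s i) inj

    -- Injectivity of ι is asked for only after g and the colour are given, since the construction
    -- runs through all functions ι.
    partiteLemma : ∀ (χ : Vec (Fin p × Fin w⁺) a → Fin (suc k)) →
      Σ (Fin p → Fin w → Fin w⁺) λ g → PartiteEmb e e⁺ g × Σ (Fin (suc k)) λ col →
        Injective _≡_ _≡_ ι → ∀ s → CopyOver ι A e s → χ (tabulate (λ i → ι i , g (ι i) (s i))) ≡ col
    partiteLemma χ with L , star , col , mono ← proj₂ HJ (λ h → χ (tabulate (λ i → ι i , point h i)))
      = alongLine L , alongLine-emb L star , col , λ inj s copy → let c , eq = copy-letter s copy in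
        trans (cong χ (Vecₚ.tabulate-cong (λ i → cong (ι i ,_) (alongLine-point L c s inj eq i)))) (mono c)

  open PartiteLemma using (partiteLemma)

  -- Powers are formed one ι after another, and a colouring is then pulled back from the last to the
  -- first. Colours fixed for later ι survive because partite embeddings send copies over ι to
  -- copies over ι. In the end the colour of a copy depends on its parts alone.
  partiteConstruction : ∀ k (A : Graph (Fin a)) (ιs : List (Fin a → Fin p)) (e : Partite p w) →
    Σ ℕ λ w⁺ → Σ (Partite p w⁺) λ e⁺ → ∀ (χ : Vec (Fin p × Fin w⁺) a → Fin (suc k)) →
      Σ (Fin p → Fin w → Fin w⁺) λ g → PartiteEmb e e⁺ g × (∀ {ι} → ι ∈ˡ ιs → Σ (Fin (suc k)) λ col →
        Injective _≡_ _≡_ ι → ∀ s → CopyOver ι A e s → χ (tabulate (λ i → ι i , g (ι i) (s i))) ≡ col)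
  partiteConstruction k A [] e = _ , e , λ χ → (λ _ v → v) , (λ _ _ _ _ _ → refl) , λ ()
  partiteConstruction {a} {p} {w} k A (ι₀ ∷ ιs) e
    with w₂ , e₂ , rest ← partiteConstruction k A ιs (PartiteLemma.e⁺ k A ι₀ e)
    = w₂ , e₂ , compose
    where
    e₁ = PartiteLemma.e⁺ k A ι₀ e
    compose : ∀ (χ : Vec (Fin p × Fin w₂) a → Fin (suc k)) →
      Σ (Fin p → Fin w → Fin w₂) λ g → PartiteEmb e e₂ g × (∀ {ι} → ι ∈ˡ (ι₀ ∷ ιs) → Σ (Fin (suc k)) λ col →
        Injective _≡_ _≡_ ι → ∀ s → CopyOver ι A e s → χ (tabulate (λ i → ι i , g (ι i) (s i))) ≡ col)
    compose χ
      with g₂ , emb₂ , mono₂ ← rest χ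
      with g₁ , emb₁ , col , mono₁ ← partiteLemma k A ι₀ e (λ t → χ (Vec.map (λ { (j , v) → j , g₂ j v }) t))
      = (λ j → g₂ j ∘ g₁ j)
      , (λ j v j′ v′ lt → trans (emb₂ j (g₁ j v) j′ (g₁ j′ v′) lt) (emb₁ j v j′ v′ lt))
      , λ { (here refl) → col , λ inj s copy →
              trans (cong χ (Vecₚ.tabulate-∘ _ (λ i → ι₀ i , g₁ (ι₀ i) (s i)))) (mono₁ inj s copy)
          ; {ι} (there ι∈) → let col′ , mono = mono₂ ι∈ in col′ , λ inj s copy →
              mono inj (λ i → g₁ (ι i) (s i)) λ i i′ lt → trans (emb₁ _ _ _ _ lt) (copy i i′ lt) }

  EdgePreserving : ∀ {V : Set} → Graph (Fin a) → Graph V → (Fin a → V) → Set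
  EdgePreserving A G f = ∀ {i j} → i Fin.< j → G (f i) (f j) ≡ A i j

  increasing⇒injective : {f : Fin a → Fin b} → Increasing f → Injective _≡_ _≡_ f
  increasing⇒injective inc {i} {j} eq with Finₚ.<-cmp i j
  ... | tri< i<j _ _ = contradiction eq (Finₚ.<⇒≢ (inc i<j))
  ... | tri≈ _ i≡j _ = i≡j
  ... | tri> _ _ j<i = contradiction (sym eq) (Finₚ.<⇒≢ (inc j<i))

  increasing⇒reflecting : {f : Fin a → Fin b} → Increasing f → ∀ {i j} → f i Fin.< f j → i Fin.< j
  increasing⇒reflecting {f = f} inc {i} {j} lt with Finₚ.<-cmp i j
  ... | tri< i<j _ _ = i<j
  ... | tri≈ _ refl _ = contradiction lt (ℕₚ.<-irrefl refl)
  ... | tri> _ _ j<i = contradiction lt (ℕₚ.<-asym (inc j<i))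

  -- The partition arrow `host` → (B)^A_k. Copies are given by increasing maps, since a linear order
  -- leaves no other parametrisation.
  record Arrow {a b} (k : ℕ) (A : Graph (Fin a)) (B : Graph (Fin b)) : Set where
    constructor arrow
    field
      order : ℕ
      host  : Graph (Fin order)
      find  : ∀ (χ : Vec (Fin order) a → Fin k) →
        Σ (Fin b → Fin order) λ v → Increasing v × EdgePreserving B host v ×
          Σ (Fin k) λ col → ∀ (u : Fin a → Fin b) → Increasing u → EdgePreserving A B u →
            χ (tabulate (v ∘ u)) ≡ col

  -- The initial system has a copy of B over every choice of b among r parts. Once the colour of a
  -- copy of A depends only on its parts, Ramsey's theorem finds b parts on which this colour is
  -- constant.
  orderedGraphRamsey : ∀ k (A : Graph (Fin a)) (B : Graph (Fin b)) → Arrow (suc k) A B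
  orderedGraphRamsey {a} {b} k A B = arrow c C find
    where
    r = proj₁ (ramsey k a b)

    tuples : List (Fin a → Fin r)
    tuples = List.map finToFun (allFin (r ^ a))

    -- The vertices (_ , y) form a copy of B over the parts κ 0, κ 1, …, where y codes κ;
    -- the edges between different y do not matter.
    e₀ : Partite r (r ^ b)
    e₀ (j , y) (j′ , _) = pushforward (finToFun y) B j j′

    construction = partiteConstruction k A tuples e₀
    q = proj₁ construction
    e = proj₁ (proj₂ construction)
    c = r * q
    C : Graph (Fin c)
    -- `remQuot` reads the part as the leading digit, so vertices in different parts are ordered as
    -- their parts.
    C x y = e (remQuot {r} q x) (remQuot {r} q y)

    find : ∀ (χ : Vec (Fin c) a → Fin (suc k)) →
      Σ (Fin b → Fin c) λ v → Increasing v × EdgePreserving B C v ×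
        Σ (Fin (suc k)) λ col → ∀ (u : Fin a → Fin b) → Increasing u → EdgePreserving A B u →
          χ (tabulate (v ∘ u)) ≡ col
    find χ
      with g , emb , mono ← proj₂ (proj₂ construction) (χ ∘ Vec.map (uncurry combine))
      -- The parts themselves are coloured: an a-tuple of parts receives the common colour of the
      -- copies of A over it.
      with κ , κ-inc , col , hom ← proj₂ (ramsey k a b)
        (λ t → proj₁ (mono (∈-map⁺ finToFun (∈-allFin (funToFin (lookup t))))))
      = v , v-inc , v-edges , col , v-mono
      where
      y = funToFin κ
      v : Fin b → Fin c
      v i = combine (κ i) (g (κ i) y)
      v-inc : Increasing v
      v-inc i<j = Finₚ.combine-monoˡ-< _ _ (κ-inc i<j)
      e₀-κ : ∀ i j → e₀ (κ i , y) (κ j , y) ≡ B i j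
      e₀-κ i j = trans
        (cong₂ (pushforward (finToFun y) B) (sym (Finₚ.finToFun-funToFin κ i)) (sym (Finₚ.finToFun-funToFin κ j)))
        (pushforward-image B (λ {i} {i′} eq → increasing⇒injective κ-inc
          (trans (sym (Finₚ.finToFun-funToFin κ i)) (trans eq (Finₚ.finToFun-funToFin κ i′)))) i j)
      v-edges : EdgePreserving B C v
      v-edges {i} {j} i<j = begin
        C (v i) (v j)                              ≡⟨ cong₂ e (Finₚ.remQuot-combine _ _) (Finₚ.remQuot-combine _ _) ⟩
        e (κ i , g (κ i) y) (κ j , g (κ j) y)      ≡⟨ emb (κ i) y (κ j) y (κ-inc i<j) ⟩
        e₀ (κ i , y) (κ j , y)                     ≡⟨ e₀-κ i j ⟩
        B i j                                      ∎
      v-mono : ∀ (u : Fin a → Fin b) → Increasing u → EdgePreserving A B u → χ (tabulate (v ∘ u)) ≡ col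
      v-mono u u-inc u-edges = begin
        χ (tabulate (v ∘ u))
          ≡⟨ cong χ (Vecₚ.tabulate-cong (λ i → cong (λ j → combine j (g j y)) (ι≡ i))) ⟨
        χ (tabulate (λ i → combine (ι i) (g (ι i) y)))
          ≡⟨ cong χ (Vecₚ.tabulate-∘ (uncurry combine) (λ i → ι i , g (ι i) y)) ⟩
        χ (Vec.map (uncurry combine) (tabulate (λ i → ι i , g (ι i) y)))
          ≡⟨ proj₂ (mono (∈-map⁺ finToFun (∈-allFin _))) ι-inj (λ _ → y) copy ⟩
        proj₁ (mono (∈-map⁺ finToFun (∈-allFin (funToFin (lookup (tabulate (κ ∘ u)))))))
          ≡⟨ hom u u-inc ⟩
        col  ∎
        where
        ι : Fin a → Fin r
        -- Membership in `tuples` is propositional equality of functions, so the colour is attached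
        -- to this coded form of `κ ∘ u`, which equals it only pointwise.
        ι = finToFun (funToFin (lookup (tabulate (κ ∘ u))))
        ι≡ : ∀ i → ι i ≡ κ (u i)
        ι≡ i = trans (Finₚ.finToFun-funToFin _ i) (Vecₚ.lookup∘tabulate (κ ∘ u) i)
        ι-inj : Injective _≡_ _≡_ ι
        ι-inj {i} {i′} eq = increasing⇒injective {f = κ ∘ u} (κ-inc ∘ u-inc) (trans (sym (ι≡ i)) (trans eq (ι≡ i′)))
        copy : CopyOver ι A e₀ (λ _ → y)
        copy i i′ lt = begin
          e₀ (ι i , y) (ι i′ , y)            ≡⟨ cong₂ (λ j j′ → e₀ (j , y) (j′ , y)) (ι≡ i) (ι≡ i′) ⟩
          e₀ (κ (u i) , y) (κ (u i′) , y)    ≡⟨ e₀-κ (u i) (u i′) ⟩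
          B (u i) (u i′)                     ≡⟨ u-edges i<i′ ⟩
          A i i′                             ∎
          where
          i<i′ : i Fin.< i′
          i<i′ = increasing⇒reflecting {f = κ ∘ u} (κ-inc ∘ u-inc) (subst₂ Fin._<_ (ι≡ i) (ι≡ i′) lt)

-- From ordered graphs to structures with labelled vertices.

module LabelledTournaments where

  open import Data.Bool using (true)
  open import Data.Nat using (ℕ; zero; suc; _*_)
  import Data.Nat.Properties as ℕₚ
  open import Data.Fin as Fin using (Fin; zero; suc; combine; remQuot)
  import Data.Fin.Properties as Finₚ
  open import Data.Fin.Subset using (Subset; _∈_; _⊆_) renaming (⊥ to ∅)
  open import Data.Fin.Subset.Properties using (⊆-antisym)
  open import Data.List as List using (List; length; allFin)
  import Data.List.Properties as Listₚ
  open import Data.List.Membership.Propositional using () renaming (_∈_ to _∈ˡ_)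
  open import Data.List.Membership.Propositional.Properties using (∈-allFin)
  import Data.List.Relation.Unary.Any as Any
  import Data.List.Relation.Unary.Any.Properties as Anyₚ
  open import Data.List.Relation.Unary.AllPairs as AllPairs using (AllPairs)
  open import Data.List.Relation.Unary.Linked.Properties using (Linked⇒AllPairs)
  open import Data.List.Relation.Unary.Unique.Propositional.Properties using (allFin⁺)
  open import Data.List.Relation.Binary.Permutation.Propositional using (↭-sym; ↭⇒↭ₛ)
  open import Data.List.Relation.Binary.Permutation.Propositional.Properties using (↭-length; ∈-resp-↭)
  import Data.List.Relation.Binary.Permutation.Setoid.Properties as Permₚ
  import Data.List.Sort as Sort
  open import Data.Vec using (Vec; tabulate; lookup)
  import Data.Vec.Properties as Vecₚ
  open import Data.Product using (Σ; _×_; _,_; proj₁; proj₂; ∃; uncurry)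
  open import Data.Sum using (_⊎_; inj₁; inj₂)
  open import Relation.Nullary using (Dec; does; yes; no; ¬_; contradiction; _×-dec_)
  open import Relation.Nullary.Decidable using (does-⇔)
  open import Function.Bundles using (mk⇔)
  open import Function using (_∘_; id)
  open import Relation.Binary.Definitions using (DecidableEquality; Trichotomous; Tri; tri<; tri≈; tri>)
  open import Relation.Binary.Structures using (IsStrictTotalOrder)
  open import Relation.Binary.Structures.Biased using (isStrictTotalOrderᶜ)
  open import Relation.Binary.Bundles using (StrictTotalOrder)
  import Relation.Binary.Properties.StrictTotalOrder as STOₚ
  open import Relation.Binary.PropositionalEquality
  open RamseyTheorem using (Increasing; lookup-AllPairs)
  open OrderedGraphs

  private variable
    a b c N : ℕ
    I X : Set
    P Q R : Set

  ⇔-sym : P ⇔ Q → Q ⇔ P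
  ⇔-sym (f , g) = g , f

  ⇔-trans : P ⇔ Q → Q ⇔ R → P ⇔ R
  ⇔-trans (f , g) (h , k) = h ∘ f , g ∘ k

  ⇔-cong : (F : X → X → Set) {x x′ y y′ : X} → x ≡ x′ → y ≡ y′ → F x y ⇔ F x′ y′
  ⇔-cong F refl refl = id , id

  does-true : (P? : Dec P) → P ⇔ (does P? ≡ true)
  does-true (yes p) = (λ _ → refl) , λ _ → p
  does-true (no ¬p) = (λ p → contradiction p ¬p) , λ ()

  sortedEnumeration : {_≺_ : Fin a → Fin a → Set} → IsStrictTotalOrder _≡_ _≺_ →
    Σ (Fin a → Fin a) λ σ → (∀ {i j} → i Fin.< j → σ i ≺ σ j) × (∀ x → ∃ λ i → σ i ≡ x)
  sortedEnumeration {a} {_≺_} sto = enumerate (sort (allFin a))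
    (trans (↭-length (sort-↭ (allFin a))) (Listₚ.length-tabulate id))
    (AllPairs.zipWith strict
      ( Linked⇒AllPairs O.trans (sort-↗ (allFin a))
      , Permₚ.Unique-resp-↭ (setoid (Fin a)) (↭⇒↭ₛ (↭-sym (sort-↭ (allFin a)))) (allFin⁺ a)))
    (λ x → ∈-resp-↭ (↭-sym (sort-↭ (allFin a))) (∈-allFin x))
    where
    order : StrictTotalOrder _ _ _
    order = record { isStrictTotalOrder = sto }
    module O = STOₚ order
    open Sort O.decTotalOrder using (sort; sort-↭; sort-↗)
    strict : ∀ {x y} → (x ≺ y ⊎ x ≡ y) × x ≢ y → x ≺ y
    strict (inj₁ x≺y , _)   = x≺y
    strict (inj₂ x≡y , x≢y) = contradiction x≡y x≢y
    enumerate : ∀ {m} (ys : List (Fin a)) → length ys ≡ m → AllPairs _≺_ ys → (∀ x → x ∈ˡ ys) →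
      Σ (Fin m → Fin a) λ σ → (∀ {i j} → i Fin.< j → σ i ≺ σ j) × (∀ x → ∃ λ i → σ i ≡ x)
    enumerate ys refl sorted all =
      List.lookup ys , lookup-AllPairs sorted , λ x → Any.index (all x) , sym (Anyₚ.lookup-index (all x))

  comprehension : {P : Fin N → Set} → (∀ j → Dec (P j)) → Subset N
  comprehension P? = tabulate (does ∘ P?)

  ∈-comprehension : {P : Fin N → Set} (P? : ∀ j → Dec (P j)) → ∀ j → (j ∈ comprehension P?) ⇔ P j
  ∈-comprehension P? j =
    (λ j∈ → proj₂ (does-true (P? j)) (trans (sym (Vecₚ.lookup∘tabulate _ j)) (Vecₚ.[]=⇒lookup j∈))) ,
    (λ Pj → Vecₚ.lookup⇒[]= j _ (trans (Vecₚ.lookup∘tabulate _ j) (proj₁ (does-true (P? j)) Pj)))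

  comprehension-unique : {P : Fin N → Set} (P? : ∀ j → Dec (P j)) {S : Subset N} →
    (∀ j → (j ∈ S) ⇔ P j) → S ≡ comprehension P?
  comprehension-unique P? S≡ = ⊆-antisym
    (λ {j} j∈ → proj₂ (∈-comprehension P? j) (proj₁ (S≡ j) j∈))
    (λ {j} j∈ → proj₂ (S≡ j) (proj₁ (∈-comprehension P? j) j∈))

  imageSet : (Fin a → Fin N) → Subset N
  imageSet f = comprehension (preimage? f)

  ∈-imageSet : (f : Fin a → Fin N) → ∀ j → (j ∈ imageSet f) ⇔ (∃ λ i → f i ≡ j)
  ∈-imageSet f = ∈-comprehension (preimage? f)

  imageSet-unique : {S : Subset N} {f g : Fin a → Fin N} → (∀ j → (j ∈ S) ⇔ (∃ λ i → f i ≡ j)) →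
    (∀ i → f i ≡ g i) → S ≡ imageSet g
  imageSet-unique {g = g} S≡ f≗g = comprehension-unique (preimage? g) λ j → ⇔-trans (S≡ j)
    ((λ { (i , eq) → i , trans (sym (f≗g i)) eq }) , (λ { (i , eq) → i , trans (f≗g i) eq }))

  pullback : (M : Str I) → (Fin N → Carrier M) → FinStr I
  pullback {N = N} M φ = record
    { size = N
    ; FE   = λ x y → E M (φ x) (φ y)
    ; FLt  = λ x y → Lt M (φ x) (φ y)
    ; FU   = λ i x → U M i (φ x)
    }

  pullback-age : (M : Str I) (φ : Fin N → Carrier M) → (∀ x y → φ x ≡ φ y → x ≡ y) → Age M (pullback M φ)
  pullback-age M φ inj = record
    { fun   = φ
    ; inj   = inj
    ; presE = λ _ _ → id , id
    ; presL = λ _ _ → id , id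
    ; presU = λ _ _ → id , id
    }

  -- Vertices carry labels that capture exactly their unary predicates.  A realisation of the
  -- ordered graph e contains, for each of its vertices x and each label l, a vertex ρ l x;
  -- the E-relation between ρ l x and ρ l′ x′ agrees with e as far as the labels permit.
  record LabelledTournament {I : Set} (T : Str I) : Set where
    field
      _≟_        : DecidableEquality (Carrier T)
      tournament : IsOrderedTournament T
      ℓ          : ℕ
      label      : Carrier T → Fin ℓ
      label⇒U    : ∀ i {s t} → label s ≡ label t → U T i s → U T i t
      U⇒label    : ∀ s t → (∀ i → U T i s ⇔ U T i t) → label s ≡ label t
      realise    : ∀ {c} (e : Graph (Fin c)) → Σ (Fin ℓ → Fin c → Carrier T) λ ρ →
        (∀ l x → label (ρ l x) ≡ l) ×
        (∀ l l′ {x x′} → x Fin.< x′ → Lt T (ρ l x) (ρ l′ x′)) ×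
        (∀ {x x′} → x Fin.< x′ → ∀ {s t} → Lt T s t → (E T s t ⇔ (e x x′ ≡ true)) →
          E T s t ⇔ E T (ρ (label s) x) (ρ (label t) x′))

  module Transfer {I : Set} {T : Str I} (L : LabelledTournament T) (n : ℕ) where
    open LabelledTournament L

    M : Str (I ⊎ Fin n)
    M = In n T

    E-irr : ∀ x → ¬ E T x x
    E-irr = proj₁ tournament
    E-asym : ∀ x y → E T x y → ¬ E T y x
    E-asym = proj₁ (proj₂ tournament)
    E-total : ∀ x y → x ≢ y → E T x y ⊎ E T y x
    E-total = proj₁ (proj₂ (proj₂ tournament))
    Lt-irr : ∀ x → ¬ Lt T x x
    Lt-irr = proj₁ (proj₂ (proj₂ (proj₂ tournament)))
    Lt-trans : ∀ x y z → Lt T x y → Lt T y z → Lt T x z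
    Lt-trans = proj₁ (proj₂ (proj₂ (proj₂ (proj₂ tournament))))
    Lt-total : ∀ x y → x ≢ y → Lt T x y ⊎ Lt T y x
    Lt-total = proj₂ (proj₂ (proj₂ (proj₂ (proj₂ tournament))))

    E? : ∀ x y → Dec (E T x y)
    E? x y with x ≟ y
    ... | yes refl = no (E-irr x)
    ... | no x≢y with E-total x y x≢y
    ...   | inj₁ xy = yes xy
    ...   | inj₂ yx = no (E-asym y x yx)

    EM? : ∀ p q → Dec (E M p q)
    EM? (k , x) (l , y) = (k Finₚ.≟ l) ×-dec E? x y

    Lt⇒≢ : ∀ {x y} → Lt T x y → x ≢ y
    Lt⇒≢ lt refl = Lt-irr _ lt

    Lt-asym : ∀ {x y} → Lt T x y → ¬ Lt T y x
    Lt-asym lt gt = Lt-irr _ (Lt-trans _ _ _ lt gt)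

    compareM : Trichotomous _≡_ (Lt M)
    compareM (k , x) (l , y) with Finₚ.<-cmp k l
    ... | tri< k<l k≢l l≮k = tri< (inj₁ k<l) (λ { refl → k≢l refl })
            (λ { (inj₁ l<k) → l≮k l<k ; (inj₂ (refl , _)) → k≢l refl })
    ... | tri> k≮l k≢l l<k = tri> (λ { (inj₁ k<l) → k≮l k<l ; (inj₂ (refl , _)) → k≢l refl })
            (λ { refl → k≢l refl }) (inj₁ l<k)
    ... | tri≈ k≮k refl _ with x ≟ y
    ...   | yes refl = tri≈ irr refl irr
      where
      irr : ¬ Lt M (k , x) (k , x)
      irr (inj₁ k<k)       = k≮k k<k
      irr (inj₂ (_ , x<x)) = Lt-irr x x<x
    ...   | no x≢y with Lt-total x y x≢y
    ...     | inj₁ x<y = tri< (inj₂ (refl , x<y)) (λ { refl → x≢y refl })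
                (λ { (inj₁ k<k) → k≮k k<k ; (inj₂ (_ , y<x)) → Lt-asym x<y y<x })
    ...     | inj₂ y<x = tri> (λ { (inj₁ k<k) → k≮k k<k ; (inj₂ (_ , x<y)) → Lt-asym x<y y<x })
                (λ { refl → x≢y refl }) (inj₂ (refl , y<x))

    LtM-trans : ∀ p q r → Lt M p q → Lt M q r → Lt M p r
    LtM-trans _ _ _ (inj₁ k<l)          (inj₁ l<m)          = inj₁ (ℕₚ.<-trans k<l l<m)
    LtM-trans _ _ _ (inj₁ k<l)          (inj₂ (refl , _))   = inj₁ k<l
    LtM-trans _ _ _ (inj₂ (refl , _))   (inj₁ l<m)          = inj₁ l<m
    LtM-trans _ _ _ (inj₂ (refl , x<y)) (inj₂ (refl , y<z)) = inj₂ (refl , Lt-trans _ _ _ x<y y<z)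

    LtM-irr : ∀ p → ¬ Lt M p p
    LtM-irr p lt with compareM p p
    ... | tri< _ p≢p _ = p≢p refl
    ... | tri≈ p≮p _ _ = p≮p lt
    ... | tri> _ p≢p _ = p≢p refl

    Ascending : (Fin a → Carrier M) → Set
    Ascending q = ∀ {i j} → i Fin.< j → Lt M (q i) (q j)

    ascending⇒⇔ : {q : Fin a → Carrier M} → Ascending q → ∀ i j → (i Fin.< j) ⇔ Lt M (q i) (q j)
    ascending⇒⇔ {q = q} asc i j = asc , reflect
      where
      reflect : Lt M (q i) (q j) → i Fin.< j
      reflect lt with Finₚ.<-cmp i j
      ... | tri< i<j _ _  = i<j
      ... | tri≈ _ refl _ = contradiction lt (LtM-irr _)
      ... | tri> _ _ j<i  = contradiction (LtM-trans _ _ _ lt (asc j<i)) (LtM-irr _)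

    ascending⇒injective : {q : Fin a → Carrier M} → Ascending q → ∀ {i j} → q i ≡ q j → i ≡ j
    ascending⇒injective {q = q} asc {i} {j} eq with Finₚ.<-cmp i j
    ... | tri< i<j _ _ = contradiction (subst (Lt M (q i)) (sym eq) (asc i<j)) (LtM-irr _)
    ... | tri≈ _ i≡j _ = i≡j
    ... | tri> _ _ j<i = contradiction (subst (Lt M (q j)) eq (asc j<i)) (LtM-irr _)

    labelM : Carrier M → Fin n × Fin ℓ
    labelM (m , t) = m , label t

    -- The points are listed in increasing order of the structure, which turns it into an ordered
    -- graph with labels; `rank` leads back to the original vertices.
    record Enumeration (A : FinStr (I ⊎ Fin n)) : Set where
      field
        emb       : Emb (toStr A) M
        σ         : Fin (size A) → Fin (size A)
        ascending : Ascending (fun emb ∘ σ)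
        rank      : Fin (size A) → Fin (size A)
        σ-rank    : ∀ x → σ (rank x) ≡ x
      pts : Fin (size A) → Carrier M
      pts = fun emb ∘ σ
      graph : Graph (Fin (size A))
      graph i j = does (EM? (pts i) (pts j))
      labels : Fin (size A) → Fin n × Fin ℓ
      labels = labelM ∘ pts

    enumeration : ∀ {A} → Age M A → Enumeration A
    enumeration {A} f = record
      { emb = f ; σ = proj₁ sorted ; ascending = proj₁ (proj₂ sorted)
      ; rank = λ x → proj₁ (proj₂ (proj₂ sorted) x) ; σ-rank = λ x → proj₂ (proj₂ (proj₂ sorted) x) }
      where
      sorted = sortedEnumeration {_≺_ = λ x y → Lt M (fun f x) (fun f y)} (isStrictTotalOrderᶜ (record
        { isEquivalence = isEquivalence
        ; trans = λ {x} {y} {z} → LtM-trans (fun f x) (fun f y) (fun f z)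
        ; compare = λ x y → cmp x y (compareM (fun f x) (fun f y)) }))
        where
        cmp : ∀ x y → Tri (Lt M (fun f x) (fun f y)) (fun f x ≡ fun f y) (Lt M (fun f y) (fun f x)) →
          Tri (Lt M (fun f x) (fun f y)) (x ≡ y) (Lt M (fun f y) (fun f x))
        cmp x y (tri< lt ¬eq ¬gt) = tri< lt (¬eq ∘ cong (fun f)) ¬gt
        cmp x y (tri≈ ¬lt eq ¬gt) = tri≈ ¬lt (inj f x y eq) ¬gt
        cmp x y (tri> ¬lt ¬eq gt) = tri> ¬lt (¬eq ∘ cong (fun f)) gt

    module Realised {c : ℕ} (e : Graph (Fin c)) where
      ρ : Fin ℓ → Fin c → Carrier T
      ρ = proj₁ (realise e)

      ρ-label : ∀ l x → label (ρ l x) ≡ l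
      ρ-label = proj₁ (proj₂ (realise e))

      ρ-mono : ∀ l l′ {x x′} → x Fin.< x′ → Lt T (ρ l x) (ρ l′ x′)
      ρ-mono = proj₁ (proj₂ (proj₂ (realise e)))

      ρ-E : ∀ {x x′} → x Fin.< x′ → ∀ {s t} → Lt T s t → (E T s t ⇔ (e x x′ ≡ true)) →
        E T s t ⇔ E T (ρ (label s) x) (ρ (label t) x′)
      ρ-E = proj₂ (proj₂ (proj₂ (realise e)))

      -- Different x are separated by the order, and different l over one x by the label.
      ρ-injective : ∀ {l l′ x x′} → ρ l x ≡ ρ l′ x′ → l ≡ l′ × x ≡ x′
      ρ-injective {l} {l′} {x} {x′} eq with Finₚ.<-cmp x x′
      ... | tri< lt _ _ = contradiction eq (Lt⇒≢ (ρ-mono l l′ lt))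
      ... | tri≈ _ x≡ _ = trans (sym (ρ-label l x)) (trans (cong label eq) (ρ-label l′ x′)) , x≡
      ... | tri> _ _ gt = contradiction (sym eq) (Lt⇒≢ (ρ-mono l′ l gt))

      encode : Fin n × Fin ℓ → Fin c → Fin (n * (ℓ * c))
      encode (m , l) x = combine m (combine l x)

      place : Fin n × Fin ℓ → Fin c → Carrier M
      place (m , l) x = m , ρ l x

      decode : Fin n × Fin (ℓ * c) → Carrier M
      decode (m , z) = m , uncurry ρ (remQuot {ℓ} c z)

      φ : Fin (n * (ℓ * c)) → Carrier M
      φ z = decode (remQuot {n} (ℓ * c) z)

      φ-encode : ∀ ml x → φ (encode ml x) ≡ place ml x
      φ-encode (m , l) x = trans (cong decode (Finₚ.remQuot-combine {n} m (combine l x)))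
        (cong (λ lx → m , uncurry ρ lx) (Finₚ.remQuot-combine {ℓ} l x))

      place-injective : ∀ {ml ml′ x x′} → place ml x ≡ place ml′ x′ → ml ≡ ml′ × x ≡ x′
      place-injective eq with ρ-injective (cong proj₂ eq) | cong proj₁ eq
      ... | refl , refl | refl = refl , refl

      encode-surjective : ∀ z → ∃ λ ml → ∃ λ x → encode ml x ≡ z
      encode-surjective z with m , z′ , refl ← Finₚ.combine-surjective {n} z
        with l , x , refl ← Finₚ.combine-surjective {ℓ} z′ = (m , l) , x , refl

      φ-injective : ∀ z z′ → φ z ≡ φ z′ → z ≡ z′
      φ-injective z z′ eq
        with ml , x , refl ← encode-surjective z | ml′ , x′ , refl ← encode-surjective z′
        with refl , refl ← place-injective (trans (sym (φ-encode ml x)) (trans eq (φ-encode ml′ x′))) = refl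

      -- This is the C⁺ of the overview, with label set `Fin n × Fin ℓ`; the ordered graph called C
      -- there is e.
      C : FinStr (I ⊎ Fin n)
      C = pullback M φ

      C-age : Age M C
      C-age = pullback-age M φ φ-injective

      -- A copy v of B as an ordered graph becomes a copy of B in `C` when v i is given the label of
      -- the i-th point of B.
      module Placed {B} (enum : Enumeration B) {v : Fin (size B) → Fin c}
                    (v-inc : Increasing v) (v-edges : EdgePreserving (Enumeration.graph enum) e v) where
        open Enumeration enum

        placed : Fin (size B) → Carrier M
        placed i = place (labels i) (v i)

        -- Blocks are compared first. Along the enumeration of B the block never decreases and is
        -- unchanged by the placing; within a block the order is that of v.
        placed-ascending : Ascending placed
        placed-ascending {i} {j} i<j with ascending i<j
        ... | inj₁ m<m′      = inj₁ m<m′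
        ... | inj₂ (m≡m′ , _) = inj₂ (m≡m′ , ρ-mono _ _ (v-inc i<j))

        placed-Lt : ∀ i j → Lt M (pts i) (pts j) ⇔ Lt M (placed i) (placed j)
        placed-Lt i j = ⇔-trans (⇔-sym (ascending⇒⇔ ascending i j)) (ascending⇒⇔ placed-ascending i j)

        ordered : ∀ {i j} → i Fin.< j → proj₁ (pts i) ≡ proj₁ (pts j) → Lt T (proj₂ (pts i)) (proj₂ (pts j))
        ordered i<j m≡m′ with ascending i<j
        ... | inj₁ m<m′     = contradiction m≡m′ (Finₚ.<⇒≢ m<m′)
        ... | inj₂ (_ , lt) = lt

        forward : ∀ {i j} → i Fin.< j → proj₁ (pts i) ≡ proj₁ (pts j) →
          E T (proj₂ (pts i)) (proj₂ (pts j)) ⇔ E T (proj₂ (placed i)) (proj₂ (placed j))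
        forward {i} {j} i<j m≡m′ = ρ-E (v-inc i<j) (ordered i<j m≡m′) (⇔-trans
          (⇔-trans ((m≡m′ ,_) , proj₂) (does-true (EM? (pts i) (pts j))))
          (⇔-cong _≡_ (sym (v-edges i<j)) refl))

        -- Exactly one direction holds between distinct points of a tournament, so agreement in one
        -- direction forces it in the other.
        reverse : ∀ {s t s′ t′} → s ≢ t → s′ ≢ t′ → E T s t ⇔ E T s′ t′ → E T t s → E T t′ s′
        reverse {s} {t} {s′} {t′} s≢t s′≢t′ iff ts with E-total s′ t′ s′≢t′
        ... | inj₁ s′t′ = contradiction ts (E-asym _ _ (proj₂ iff s′t′))
        ... | inj₂ t′s′ = t′s′

        backward : ∀ {i j} → j Fin.< i → proj₁ (pts j) ≡ proj₁ (pts i) →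
          E T (proj₂ (pts i)) (proj₂ (pts j)) ⇔ E T (proj₂ (placed i)) (proj₂ (placed j))
        backward j<i m≡m′ = reverse ne ne′ iff , reverse ne′ ne (⇔-sym iff)
          where
          iff = forward j<i m≡m′
          ne  = Lt⇒≢ (ordered j<i m≡m′)
          ne′ = Lt⇒≢ (ρ-mono _ _ (v-inc j<i))

        placed-E : ∀ i j → E M (pts i) (pts j) ⇔ E M (placed i) (placed j)
        placed-E i j with Finₚ.<-cmp i j
        ... | tri< i<j _ _  = (λ { (eq , st) → eq , proj₁ (forward i<j eq) st }) ,
                              (λ { (eq , st) → eq , proj₂ (forward i<j eq) st })
        ... | tri≈ _ refl _ = (λ { (_ , ss) → contradiction ss (E-irr _) }) ,
                              (λ { (_ , ss) → contradiction ss (E-irr _) })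
        ... | tri> _ _ j<i  = (λ { (eq , st) → eq , proj₁ (backward j<i (sym eq)) st }) ,
                              (λ { (eq , st) → eq , proj₂ (backward j<i (sym eq)) st })

        placed-U : ∀ q i → U M q (pts i) ⇔ U M q (placed i)
        placed-U (inj₁ q) i = label⇒U q (sym (ρ-label _ _)) , label⇒U q (ρ-label _ _)
        placed-U (inj₂ q) i = id , id

        vertex : Fin (size B) → Fin (n * (ℓ * c))
        vertex i = encode (labels i) (v i)

        φ-vertex : ∀ i → φ (vertex i) ≡ placed i
        φ-vertex i = φ-encode (labels i) (v i)

        pts-rank : ∀ x → fun emb x ≡ pts (rank x)
        pts-rank x = cong (fun emb) (sym (σ-rank x))

        placedEmb : Emb (toStr B) (toStr C)
        placedEmb = record
          { fun   = vertex ∘ rank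
          ; inj   = λ x y eq → trans (sym (σ-rank x)) (trans (cong σ (ascending⇒injective placed-ascending
                      (trans (sym (φ-vertex (rank x))) (trans (cong φ eq) (φ-vertex (rank y)))))) (σ-rank y))
          ; presE = λ x y → ⇔-trans (presE emb x y) (⇔-trans (⇔-cong (E M) (pts-rank x) (pts-rank y))
                      (⇔-trans (placed-E (rank x) (rank y))
                        (⇔-sym (⇔-cong (E M) (φ-vertex (rank x)) (φ-vertex (rank y))))))
          ; presL = λ x y → ⇔-trans (presL emb x y) (⇔-trans (⇔-cong (Lt M) (pts-rank x) (pts-rank y))
                      (⇔-trans (placed-Lt (rank x) (rank y))
                        (⇔-sym (⇔-cong (Lt M) (φ-vertex (rank x)) (φ-vertex (rank y))))))
          ; presU = λ q x → ⇔-trans (presU emb q x) (⇔-trans (⇔-cong (λ p _ → U M q p) (pts-rank x) (pts-rank x))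
                      (⇔-trans (placed-U q (rank x))
                        (⇔-sym (⇔-cong (λ p _ → U M q p) (φ-vertex (rank x)) (φ-vertex (rank x))))))
          }

        -- An embedding of A into C with image in the placed copy of B comes from an ordered
        -- graph embedding u of the enumerated structures.
        module Restrict {A} (enumA : Enumeration A) (f : Emb (toStr A) (toStr C))
                        (inside : ∀ x → ∃ λ y → vertex (rank y) ≡ fun f x) where
          private module A = Enumeration enumA

          u : Fin (size A) → Fin (size B)
          u i = rank (proj₁ (inside (A.σ i)))

          vertex-u : ∀ i → vertex (u i) ≡ fun f (A.σ i)
          vertex-u i = proj₂ (inside (A.σ i))

          φ-u : ∀ i → φ (fun f (A.σ i)) ≡ placed (u i)
          φ-u i = trans (cong φ (sym (vertex-u i))) (φ-vertex (u i))

          Lt-u : ∀ i j → Lt M (A.pts i) (A.pts j) ⇔ Lt M (placed (u i)) (placed (u j))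
          Lt-u i j = ⇔-trans (⇔-sym (presL A.emb _ _)) (⇔-trans (presL f _ _) (⇔-cong (Lt M) (φ-u i) (φ-u j)))

          E-u : ∀ i j → E M (A.pts i) (A.pts j) ⇔ E M (pts (u i)) (pts (u j))
          E-u i j = ⇔-trans (⇔-sym (presE A.emb _ _)) (⇔-trans (presE f _ _)
            (⇔-trans (⇔-cong (E M) (φ-u i) (φ-u j)) (⇔-sym (placed-E (u i) (u j)))))

          U-u : ∀ q i → U M q (A.pts i) ⇔ U M q (pts (u i))
          U-u q i = ⇔-trans (⇔-sym (presU A.emb q _)) (⇔-trans (presU f q _)
            (⇔-trans (⇔-cong (λ p _ → U M q p) (φ-u i) (φ-u i)) (⇔-sym (placed-U q (u i)))))

          u-inc : Increasing u
          u-inc {i} {j} i<j = proj₂ (ascending⇒⇔ placed-ascending (u i) (u j)) (proj₁ (Lt-u i j) (A.ascending i<j))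

          u-edges : EdgePreserving A.graph graph u
          u-edges {i} {j} _ = does-⇔ (uncurry mk⇔ (⇔-sym (E-u i j))) (EM? _ _) (EM? _ _)

          -- The predicates P_m fix the block and those of T fix the label; f and the placing
          -- preserve both.
          labels-u : ∀ i → labels (u i) ≡ A.labels i
          labels-u i = cong₂ _,_ (proj₁ (U-u (inj₂ _) i) refl)
            (sym (U⇒label _ _ (λ q → U-u (inj₁ q) i)))

          -- The copy is determined by the ordered graph copy `v ∘ u` and the labels of A. Its
          -- colour is therefore the one already assigned to `v ∘ u` in the ordered graph.
          f≡ : ∀ x → fun f x ≡ encode (A.labels (A.rank x)) (v (u (A.rank x)))
          f≡ x = trans (cong (fun f) (sym (A.σ-rank x))) (trans (sym (vertex-u (A.rank x)))
            (cong (λ l → encode l (v (u (A.rank x)))) (labels-u (A.rank x))))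

    module Lift {k} {A B} (enumA : Enumeration A) (enumB : Enumeration B)
                (ramsey : Arrow k (Enumeration.graph enumA) (Enumeration.graph enumB)) where
      open Arrow ramsey
      private
        module A = Enumeration enumA
        module B = Enumeration enumB
      open Realised host

      copySet : Vec (Fin order) (size A) → Subset (size C)
      copySet t = imageSet (λ x → encode (A.labels (A.rank x)) (lookup t (A.rank x)))

      lift : Σ (FinStr (I ⊎ Fin n)) λ C → Age M C ×
        (∀ (χ : Subset (size C) → Fin k) →
          Σ (Subset (size C)) λ B′ → IsCopy B C B′ ×
            Σ (Fin k) λ col → ∀ S → IsCopy A C S → S ⊆ B′ → χ S ≡ col)
      lift = C , C-age , λ χ → extend χ (find (χ ∘ copySet))
        where
        extend : ∀ (χ : Subset (size C) → Fin k) → _ → Σ (Subset (size C)) λ B′ → IsCopy B C B′ ×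
            Σ (Fin k) λ col → ∀ S → IsCopy A C S → S ⊆ B′ → χ S ≡ col
        extend χ (v , v-inc , v-edges , col , mono) =
          imageSet (vertex ∘ B.rank) , (placedEmb , ∈-imageSet (vertex ∘ B.rank)) , col , λ S (f , S≡) S⊆ →
          let open Restrict enumA f (λ x →
                proj₁ (∈-imageSet (vertex ∘ B.rank) (fun f x)) (S⊆ (proj₂ (S≡ (fun f x)) (x , refl)))) in
          trans (cong χ (imageSet-unique S≡ λ x → trans (f≡ x)
                  (cong (encode (A.labels (A.rank x))) (sym (Vecₚ.lookup∘tabulate (v ∘ u) (A.rank x))))))
                (mono u u-inc u-edges)
          where open Placed enumB v-inc v-edges

    ramseyProperty : RamseyProperty (Age M)
    -- With no colours there is no χ, since even the empty subset needs a value.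
    ramseyProperty zero    A B KA KB = B , KB , λ χ → contradiction (χ ∅) λ ()
    ramseyProperty (suc k) A B KA KB = Lift.lift (enumeration KA) (enumeration KB) (orderedGraphRamsey k _ _)

-- Structures whose points are told apart by unary predicates: I_1 and C_3.

module RigidStructures where

  import Data.Fin.Properties as Finₚ
  open import Data.Fin.Subset using () renaming (⊤ to full)
  open import Data.Fin.Subset.Properties using (∈⊤)
  open import Data.Product using (_,_; proj₁; ∃)
  open import Data.Product.Properties using (≡-dec)
  open import Data.Sum using (inj₁; inj₂)
  open import Relation.Nullary using (Dec)
  open import Function using (_∘_; id)
  open import Relation.Binary.Definitions using (DecidableEquality)
  open import Relation.Binary.PropositionalEquality
  open LabelledTournaments

  private variable
    I : Set

  -- B itself is the witness. Every embedding h of A in B satisfies g ∘ h = f pointwise, so the only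
  -- candidate for a copy is the set of vertices that g sends into the image of f; its colour is
  -- taken whether or not it is a copy.
  rigid⇒ramsey : (M : Str I) → DecidableEquality (Carrier M) →
    (∀ x y → (∀ i → U M i x ⇔ U M i y) → x ≡ y) → RamseyProperty (Age M)
  rigid⇒ramsey M _≟_ rigid k A B f g = B , g , λ χ →
    full , (record { fun = id ; inj = λ _ _ → id ; presE = λ _ _ → id , id
                   ; presL = λ _ _ → id , id ; presU = λ _ _ → id , id }
           , λ j → (λ _ → j , refl) , λ _ → ∈⊤) ,
    χ (comprehension meets) , λ { S (h , S≡) _ → cong χ (comprehension-unique meets λ j → ⇔-trans (S≡ j)
      ( (λ { (i , refl) → i , agree h i })
      , (λ { (i , eq) → i , inj g _ _ (trans (sym (agree h i)) eq) }) )) }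
    where
    meets : ∀ j → Dec (∃ λ i → fun f i ≡ fun g j)
    meets j = Finₚ.any? λ i → fun f i ≟ fun g j
    agree : (h : Emb (toStr A) (toStr B)) → ∀ i → fun f i ≡ fun g (fun h i)
    agree h i = rigid _ _ λ q → ⇔-trans (⇔-sym (presU f q i)) (⇔-trans (presU h q i) (presU g q (fun h i)))

  In-rigid : ∀ n (T : Str I) → DecidableEquality (Carrier T) →
    (∀ x y → (∀ i → U T i x ⇔ U T i y) → x ≡ y) → RamseyProperty (Age (In n T))
  In-rigid n T _≟_ rigid = rigid⇒ramsey (In n T) (≡-dec Finₚ._≟_ _≟_) λ { (k , x) (l , y) same →
    cong₂ _,_ (sym (proj₁ (same (inj₂ k)) refl)) (rigid x y (same ∘ inj₁)) }

-- The generic tournament.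

module GenericTournament where

  open import Data.Bool using (true; false)
  open import Data.Nat using (zero; suc)
  import Data.Nat.Properties as ℕₚ
  open import Data.Fin as Fin using (Fin; zero; suc)
  import Data.Fin.Properties as Finₚ
  open import Data.Vec using ([]; _∷_; lookup)
  open import Data.Product using (_×_; _,_; proj₁; proj₂)
  open import Data.Sum using (_⊎_; inj₁; inj₂)
  open import Data.Empty using (⊥)
  open import Relation.Nullary using (¬_; contradiction)
  open import Relation.Nullary.Decidable using (map′)
  open import Relation.Binary.Definitions using (tri<; tri≈; tri>)
  open import Relation.Binary.PropositionalEquality
  open OrderedGraphs
  open LabelledTournaments

  module _ (M : Str ⊥) (MT : IsTωStar M) where
    private
      -- The age speaks of finite structures only, so the axioms for M are read off its
      -- substructures on one, two and three points.
      finite : ∀ {c} (φ : Fin c → Carrier M) → (∀ x y → φ x ≡ φ y → x ≡ y) →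
        IsOrderedTournament (toStr (pullback M φ))
      finite φ inj = proj₁ (proj₂ (proj₂ MT) (pullback M φ)) (pullback-age M φ inj)

      point : ∀ x → IsOrderedTournament (toStr (pullback M (lookup (x ∷ []))))
      point x = finite (lookup (x ∷ [])) λ { zero zero _ → refl }

      pair : ∀ x y → x ≢ y → IsOrderedTournament (toStr (pullback M (lookup (x ∷ y ∷ []))))
      pair x y x≢y = finite (lookup (x ∷ y ∷ [])) λ
        { zero zero _ → refl ; zero (suc zero) eq → contradiction eq x≢y
        ; (suc zero) zero eq → contradiction (sym eq) x≢y ; (suc zero) (suc zero) _ → refl }

      triple : ∀ x y z → x ≢ y → y ≢ z → x ≢ z → IsOrderedTournament (toStr (pullback M (lookup (x ∷ y ∷ z ∷ []))))
      triple x y z x≢y y≢z x≢z = finite (lookup (x ∷ y ∷ z ∷ [])) λ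
        { zero zero _ → refl ; zero (suc zero) eq → contradiction eq x≢y 
        ; zero (suc (suc zero)) eq → contradiction eq x≢z
        ; (suc zero) zero eq → contradiction (sym eq) x≢y ; (suc zero) (suc zero) _ → refl
        ; (suc zero) (suc (suc zero)) eq → contradiction eq y≢z
        ; (suc (suc zero)) zero eq → contradiction (sym eq) x≢z
        ; (suc (suc zero)) (suc zero) eq → contradiction (sym eq) y≢z
        ; (suc (suc zero)) (suc (suc zero)) _ → refl }

      E-irr : ∀ x → ¬ E M x x
      E-irr x = proj₁ (point x) zero

      Lt-irr : ∀ x → ¬ Lt M x x
      Lt-irr x = proj₁ (proj₂ (proj₂ (proj₂ (point x)))) zero

      E⇒≢ : ∀ {x y} → E M x y → x ≢ y
      E⇒≢ xy refl = E-irr _ xy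

      Lt⇒≢ : ∀ {x y} → Lt M x y → x ≢ y
      Lt⇒≢ xy refl = Lt-irr _ xy

      Lt-asym : ∀ x y → Lt M x y → ¬ Lt M y x
      Lt-asym x y xy yx = proj₁ (proj₂ (proj₂ (proj₂ xy-tournament))) zero
        (proj₁ (proj₂ (proj₂ (proj₂ (proj₂ xy-tournament)))) zero (suc zero) zero xy yx)
        where xy-tournament = pair x y (Lt⇒≢ xy)

      Lt-trans : ∀ x y z → Lt M x y → Lt M y z → Lt M x z
      Lt-trans x y z xy yz =
        proj₁ (proj₂ (proj₂ (proj₂ (proj₂ (triple x y z (Lt⇒≢ xy) (Lt⇒≢ yz) (λ { refl → Lt-asym x y xy yz }))))))
          zero (suc zero) (suc (suc zero)) xy yz

    Tω-tournament : IsOrderedTournament M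
    Tω-tournament =
      E-irr ,
      (λ x y xy → proj₁ (proj₂ (pair x y (E⇒≢ xy))) zero (suc zero) xy) ,
      (λ x y x≢y → proj₁ (proj₂ (proj₂ (pair x y x≢y))) zero (suc zero) λ ()) ,
      Lt-irr ,
      Lt-trans ,
      (λ x y x≢y → proj₂ (proj₂ (proj₂ (proj₂ (proj₂ (pair x y x≢y))))) zero (suc zero) λ ())

    -- An edge of e points up the order and a non-edge points down. The result lies in the age of M,
    -- so e is realised exactly.
    orientation : ∀ {c} → Graph (Fin c) → FinStr ⊥
    orientation {c} e = record
      { size = c
      ; FE   = λ x y → (x Fin.< y × e x y ≡ true) ⊎ (y Fin.< x × e y x ≡ false)
      ; FLt  = Fin._<_
      ; FU   = λ ()
      }

    orientation-tournament : ∀ {c} (e : Graph (Fin c)) → IsOrderedTournament (toStr (orientation e))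
    orientation-tournament e =
      (λ { x (inj₁ (x<x , _)) → ℕₚ.<-irrefl refl x<x ; x (inj₂ (x<x , _)) → ℕₚ.<-irrefl refl x<x }) ,
      (λ { x y (inj₁ (x<y , _))  (inj₁ (y<x , _))  → ℕₚ.<-asym x<y y<x
         ; x y (inj₁ (_ , eq))   (inj₂ (_ , eq′))  → contradiction (trans (sym eq) eq′) λ ()
         ; x y (inj₂ (_ , eq))   (inj₁ (_ , eq′))  → contradiction (trans (sym eq) eq′) λ ()
         ; x y (inj₂ (y<x , _))  (inj₂ (x<y , _))  → ℕₚ.<-asym x<y y<x }) ,
      E-total ,
      (λ x → ℕₚ.<-irrefl refl) , (λ _ _ _ → ℕₚ.<-trans) , Lt-total
      where
      Lt-total : ∀ x y → x ≢ y → x Fin.< y ⊎ y Fin.< x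
      Lt-total x y x≢y with Finₚ.<-cmp x y
      ... | tri< lt _ _ = inj₁ lt
      ... | tri≈ _ eq _ = contradiction eq x≢y
      ... | tri> _ _ gt = inj₂ gt
      directed : ∀ {x y} → x Fin.< y → FE (orientation e) x y ⊎ FE (orientation e) y x
      directed {x} {y} x<y with e x y
      ... | true  = inj₁ (inj₁ (x<y , refl))
      ... | false = inj₂ (inj₂ (x<y , refl))
      E-total : ∀ x y → x ≢ y → FE (orientation e) x y ⊎ FE (orientation e) y x
      E-total x y x≢y with Lt-total x y x≢y
      ... | inj₁ x<y = directed x<y
      ... | inj₂ y<x = Data.Sum.swap (directed y<x)

    labelled : LabelledTournament M
    labelled = record
      { _≟_        = λ x y → map′ (proj₂ (proj₁ MT) x y) (cong (proj₁ (proj₁ MT)))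
                     (proj₁ (proj₁ MT) x ℕₚ.≟ proj₁ (proj₁ MT) y)
      ; tournament = Tω-tournament
      ; ℓ          = 1
      ; label      = λ _ → zero
      ; label⇒U    = λ ()
      ; U⇒label    = λ _ _ _ → refl
      ; realise    = λ e → let g = proj₂ (proj₂ (proj₂ MT) (orientation e)) (orientation-tournament e) in
          (λ _ → fun g) , (λ { zero _ → refl }) , (λ _ _ → proj₁ (presL g _ _)) ,
          λ x<x′ _ iff → ⇔-trans iff (⇔-trans
            ((λ eq → inj₁ (x<x′ , eq)) , λ
              { (inj₁ (_ , eq)) → eq
              ; (inj₂ (x′<x , _)) → contradiction x′<x (ℕₚ.<-asym x<x′) })
            (presE g _ _))
      }

-- The rationals.

module RationalOrder where

  open import Data.Nat as ℕ using (suc)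
  import Data.Nat.Properties as ℕₚ
  open import Data.Integer as ℤ using (+_)
  import Data.Integer.Properties as ℤₚ
  open import Data.Rational as ℚ using (ℚ)
  import Data.Rational.Properties as ℚₚ
  import Data.Rational.Unnormalised as ℚᵘ
  import Data.Rational.Unnormalised.Properties as ℚᵘₚ
  open import Data.Fin as Fin using (Fin; zero; suc; toℕ)
  open import Data.Product using (_,_)
  open import Data.Sum using (_⊎_; inj₁; inj₂)
  open import Relation.Nullary using (¬_; contradiction)
  open import Relation.Binary.Definitions using (tri<; tri≈; tri>)
  open import Relation.Binary.PropositionalEquality
  open LabelledTournaments

  -- Cross multiplication is done on unnormalised fractions, since `ℚ._/_` reduces to lowest terms.
  fraction-< : ∀ m d n q .{{_ : ℕ.NonZero d}} .{{_ : ℕ.NonZero q}} → m ℕ.* q ℕ.< n ℕ.* d →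
    (+ m ℚ./ d) ℚ.< (+ n ℚ./ q)
  fraction-< m d@(suc d-1) n q@(suc q-1) lt =
    ℚₚ.toℚᵘ-cancel-< (ℚᵘₚ.<-respˡ-≃ (ℚᵘₚ.≃-sym (ℚₚ.toℚᵘ-fromℚᵘ (ℚᵘ.mkℚᵘ (+ m) d-1)))
      (ℚᵘₚ.<-respʳ-≃ (ℚᵘₚ.≃-sym (ℚₚ.toℚᵘ-fromℚᵘ (ℚᵘ.mkℚᵘ (+ n) q-1)))
        (ℚᵘ.*<* (subst₂ ℤ._<_ (ℤₚ.pos-* m q) (ℤₚ.pos-* n d) (ℤ.+<+ lt)))))

  labelled : LabelledTournament QStar
  labelled = record
    { _≟_        = ℚₚ._≟_
    ; tournament = irr , (λ _ _ → ℚₚ.<-asym) , total , irr , (λ _ _ _ → ℚₚ.<-trans) , total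
    ; ℓ          = 1
    ; label      = λ _ → zero
    ; label⇒U    = λ ()
    ; U⇒label    = λ _ _ _ → refl
    -- E is the order itself, so any increasing sequence will do; the integers are taken.
    ; realise    = λ e → (λ _ x → + toℕ x ℚ./ 1) , (λ { zero _ → refl }) , (λ _ _ → increasing) ,
                   λ x<x′ s<t _ → (λ _ → increasing x<x′) , λ _ → s<t
    }
    where
    increasing : ∀ {c} {x x′ : Fin c} → x Fin.< x′ → (+ toℕ x ℚ./ 1) ℚ.< (+ toℕ x′ ℚ./ 1)
    increasing {x = x} {x′} x<x′ = fraction-< (toℕ x) 1 (toℕ x′) 1 (ℕₚ.*-monoˡ-< 1 x<x′)
    irr : ∀ x → ¬ x ℚ.< x
    irr x = ℚₚ.<-irrefl refl
    total : ∀ x y → x ≢ y → x ℚ.< y ⊎ y ℚ.< x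
    total x y x≢y with ℚₚ.<-cmp x y
    ... | tri< lt _ _ = inj₁ lt
    ... | tri≈ _ eq _ = contradiction eq x≢y
    ... | tri> _ _ gt = inj₂ gt

-- The dense local order S(2).

module DenseLocalOrder where

  open import Data.Nat as ℕ using (ℕ; zero; suc)
  import Data.Nat.Properties as ℕₚ
  open import Data.Nat.Divisibility using (_∣_; _∣?_; divides; ∣-trans; ∣m+n∣m⇒∣n; ∣m⇒∣m*n; ∣1⇒≡1)
  open import Data.Nat.GCD using (gcd; gcd[m,n]∣n)
  open import Data.Nat.Primality using (prime[2]; euclidsLemma)
  import Data.Nat.Solver as ℕSolver
  open import Data.Integer as ℤ using (+_; ∣_∣)
  import Data.Integer.Properties as ℤₚ
  import Data.Integer.Divisibility.Signed as Signed
  import Data.Integer.Solver as ℤSolver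
  open import Data.Rational as ℚ using (ℚ; 0ℚ; 1ℚ; ½; _+_; _-_; _<_; _≤_; _≤?_; _<?_)
  import Data.Rational.Properties as ℚₚ
  open import Algebra.Properties.Group ℚₚ.+-0-group using () renaming (∙-cancelʳ to +-cancelʳ)
  import Data.Rational.Solver as ℚSolver
  import Data.Rational.Unnormalised as ℚᵘ
  import Data.Rational.Unnormalised.Properties as ℚᵘₚ
  open import Data.Fin as Fin using (Fin; zero; suc; toℕ)
  import Data.Fin.Properties as Finₚ
  open import Data.Product using (_×_; _,_; proj₁; proj₂; uncurry)
  open import Data.Sum as Sum using (_⊎_; inj₁; inj₂)
  open import Relation.Nullary using (Dec; yes; no; ¬_; contradiction; _×-dec_; ¬?; recompute)
  open import Relation.Nullary.Decidable using (map′; from-yes)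
  open import Function using (_∘_)
  open import Relation.Binary.Definitions using (tri<; tri≈; tri>)
  open import Relation.Binary.PropositionalEquality
  open LabelledTournaments
  open RationalOrder using (fraction-<)

  fraction-suc : ∀ m d .{{_ : ℕ.NonZero d}} → + (d ℕ.+ m) ℚ./ d ≡ (+ m ℚ./ d) + 1ℚ
  fraction-suc m d@(suc d-1) = ℚₚ.toℚᵘ-injective (begin
    ℚ.toℚᵘ (+ (d ℕ.+ m) ℚ./ d)             ≈⟨ ℚₚ.toℚᵘ-fromℚᵘ (ℚᵘ.mkℚᵘ (+ (d ℕ.+ m)) d-1) ⟩
    ℚᵘ.mkℚᵘ (+ (d ℕ.+ m)) d-1              ≈⟨ ℚᵘ.*≡* (solve 2 (λ x y →
        (x :+ y) :* (x :* con (+ 1)) := (y :* con (+ 1) :+ con (+ 1) :* x) :* x) refl (+ d) (+ m)) ⟩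
    ℚᵘ.mkℚᵘ (+ m) d-1 ℚᵘ.+ ℚ.toℚᵘ 1ℚ       ≈⟨ ℚᵘₚ.+-congˡ (ℚ.toℚᵘ 1ℚ) (ℚₚ.toℚᵘ-fromℚᵘ (ℚᵘ.mkℚᵘ (+ m) d-1)) ⟨
    ℚ.toℚᵘ (+ m ℚ./ d) ℚᵘ.+ ℚ.toℚᵘ 1ℚ      ≈⟨ ℚₚ.toℚᵘ-homo-+ (+ m ℚ./ d) 1ℚ ⟨
    ℚ.toℚᵘ ((+ m ℚ./ d) + 1ℚ)              ∎)
    where
    open ℚᵘₚ.≃-Reasoning
    open ℤSolver.+-*-Solver

  -- Positive 2-adic valuation. Adding 1 leaves this class, which excludes antipodal pairs, and ½
  -- and 3/2 are outside it.
  EvenOverOdd : ℚ → Set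
  EvenOverOdd q = (2 ∣ ∣ ℚ.numerator q ∣) × ¬ (2 ∣ ℚ.denominatorℕ q)

  -- Reduction divides by the gcd, which is odd as a divisor of d, so the parities survive.
  evenOverOdd-fraction : ∀ m d .{{_ : ℕ.NonZero d}} → 2 ∣ m → ¬ 2 ∣ d → EvenOverOdd (+ m ℚ./ d)
  evenOverOdd-fraction m d 2∣m 2∤d = even , odd
    where
    q = + m ℚ./ d
    num : ∣ ℚ.numerator q ∣ ℕ.* gcd m d ≡ m
    num = trans (sym (ℤₚ.abs-* (ℚ.numerator q) (+ gcd m d))) (cong ∣_∣ (ℚₚ.↥-normalize m d))
    den : ℚ.denominatorℕ q ℕ.* gcd m d ≡ d
    den = trans (sym (ℤₚ.abs-* (ℚ.denominator q) (+ gcd m d))) (cong ∣_∣ (ℚₚ.↧-normalize m d))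
    odd : ¬ 2 ∣ ℚ.denominatorℕ q
    odd 2∣den = 2∤d (subst (2 ∣_) den (∣m⇒∣m*n (gcd m d) 2∣den))
    even : 2 ∣ ∣ ℚ.numerator q ∣
    even with euclidsLemma ∣ ℚ.numerator q ∣ (gcd m d) prime[2] (subst (2 ∣_) (sym num) 2∣m)
    ... | inj₁ 2∣num = 2∣num
    ... | inj₂ 2∣gcd = contradiction (∣-trans 2∣gcd (gcd[m,n]∣n m d)) 2∤d

  -- Clearing denominators in q = p + 1 would make (num p + den p) · den q even, although both
  -- factors are odd.
  evenOverOdd-+1 : ∀ {p q} → EvenOverOdd p → EvenOverOdd q → q ≢ p + 1ℚ
  evenOverOdd-+1 {p@(ℚ.mkℚ _ _ _)} {q@(ℚ.mkℚ _ _ _)} (2∣p , 2∤p) (2∣q , 2∤q) eq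
    with ℚᵘ.*≡* cross ← ℚᵘₚ.≃-trans (ℚᵘₚ.≃-reflexive (cong ℚ.toℚᵘ eq)) (ℚₚ.toℚᵘ-homo-+ p 1ℚ)
    with euclidsLemma _ _ prime[2] (subst (2 ∣_) (ℤₚ.abs-* (ℚ.↥ p ℤ.* + 1 ℤ.+ + 1 ℤ.* ℚ.↧ p) (ℚ.↧ q))
      (subst (2 ∣_) (cong ∣_∣ cross) (subst (2 ∣_) (sym (ℤₚ.abs-* (ℚ.↥ q) (ℚ.↧ p ℤ.* + 1))) (∣m⇒∣m*n _ 2∣q))))
  ... | inj₂ 2∣den = 2∤q 2∣den
  ... | inj₁ 2∣sum = 2∤p (Signed.∣⇒∣ᵤ {+ 2} {ℚ.↧ p} (subst (Signed._∣_ (+ 2)) (ℤₚ.*-identityˡ (ℚ.↧ p))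
    (Signed.∣m+n∣m⇒∣n {+ 2} {ℚ.↥ p ℤ.* + 1} {+ 1 ℤ.* ℚ.↧ p} (Signed.∣ᵤ⇒∣ 2∣sum)
      (Signed.∣m⇒∣m*n (+ 1) (Signed.∣ᵤ⇒∣ {+ 2} {ℚ.↥ p} 2∣p)))))

  shift : ∀ {p q p′ q′} r → p + r ≡ p′ → q + r ≡ q′ → (p < q) ⇔ (p′ < q′)
  shift {p} {q} r refl refl = ℚₚ.+-monoˡ-< r , λ lt →
    subst₂ _<_ (back p) (back q) (ℚₚ.+-monoˡ-< (ℚ.- r) lt)
    where
    open ℚSolver.+-*-Solver
    back : ∀ s → (s + r) + ℚ.- r ≡ s
    back s = solve 2 (λ s r → (s :+ r) :+ :- r := s) refl s r

  -- E for angles in [0,2), without `ccw`: b is less than a half turn ahead of a, either directly or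
  -- across the angle 0.
  Precedes : ℚ → ℚ → Set
  Precedes a b = (a < b × b < a + 1ℚ) ⊎ (b + 1ℚ < a)

  <+1 : ∀ a → a < a + 1ℚ
  <+1 a = subst (_< a + 1ℚ) (ℚₚ.+-identityʳ a) (ℚₚ.+-monoʳ-< a (from-yes (0ℚ <? 1ℚ)))

  ≤⇒<+1 : ∀ {a b} → a ≤ b → a < b + 1ℚ
  ≤⇒<+1 {b = b} a≤b = ℚₚ.≤-<-trans a≤b (<+1 b)

  precedes-asym : ∀ {a b} → Precedes a b → ¬ Precedes b a
  precedes-asym (inj₁ (a<b , _))    (inj₁ (b<a , _))    = ℚₚ.<-asym a<b b<a
  precedes-asym (inj₁ (_ , b<a+1))  (inj₂ a+1<b)        = ℚₚ.<-asym b<a+1 a+1<b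
  precedes-asym (inj₂ b+1<a)        (inj₁ (_ , a<b+1))  = ℚₚ.<-asym b+1<a a<b+1
  precedes-asym (inj₂ b+1<a)        (inj₂ a+1<b)        =
    ℚₚ.<-asym (ℚₚ.<-trans (<+1 _) b+1<a) (ℚₚ.<-trans (<+1 _) a+1<b)

  module _ (a b : ℚ) where
    open ℚSolver.+-*-Solver

    0<-⇔ : (0ℚ < b - a) ⇔ (a < b)
    0<-⇔ = shift a (ℚₚ.+-identityˡ a) (solve 2 (λ a b → (b :- a) :+ a := b) refl a b)

    -<1⇔ : (b - a < 1ℚ) ⇔ (b < a + 1ℚ)
    -<1⇔ = shift a (solve 2 (λ a b → (b :- a) :+ a := b) refl a b) (ℚₚ.+-comm 1ℚ a)

    -+2<1⇔ : ((b - a) + 2ℚ < 1ℚ) ⇔ (b + 1ℚ < a)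
    -+2<1⇔ = shift (a - 1ℚ)
      (solve 2 (λ a b → ((b :- a) :+ con 2ℚ) :+ (a :- con 1ℚ) := b :+ con 1ℚ) refl a b)
      (solve 1 (λ a → con 1ℚ :+ (a :- con 1ℚ) := a) refl a)

    0<-+2⇔ : (0ℚ < (b - a) + 2ℚ) ⇔ (a < b + 2ℚ)
    0<-+2⇔ = shift a (ℚₚ.+-identityˡ a) (solve 2 (λ a b → ((b :- a) :+ con 2ℚ) :+ a := b :+ con 2ℚ) refl a b)

    +2<+1⇔ : (a + 2ℚ < b + 1ℚ) ⇔ (a + 1ℚ < b)
    +2<+1⇔ = ⇔-sym (shift 1ℚ (solve 1 (λ a → (a :+ con 1ℚ) :+ con 1ℚ := a :+ con 2ℚ) refl a) refl)

    +1<+2⇔ : (a + 1ℚ < b + 2ℚ) ⇔ (a < b + 1ℚ)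
    +1<+2⇔ = ⇔-sym (shift 1ℚ refl (solve 1 (λ b → (b :+ con 1ℚ) :+ con 1ℚ := b :+ con 2ℚ) refl b))

  +1≡+2 : ∀ a b → a + 1ℚ ≡ b + 2ℚ → a ≡ b + 1ℚ
  +1≡+2 a b eq = +-cancelʳ 1ℚ a (b + 1ℚ)
    (trans eq (solve 1 (λ b → b :+ con 2ℚ := (b :+ con 1ℚ) :+ con 1ℚ) refl b))
    where open ℚSolver.+-*-Solver

  ccw-precedes : ∀ a b → 0ℚ ≤ b → a < 2ℚ → ((0ℚ < ccw a b) × (ccw a b < 1ℚ)) ⇔ Precedes a b
  ccw-precedes a b 0≤b a<2 with a ≤? b
  ... | yes a≤b =
    (λ { (0< , <1) → inj₁ (proj₁ (0<-⇔ a b) 0< , proj₁ (-<1⇔ a b) <1) }) ,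
    (λ { (inj₁ (a<b , b<a+1)) → proj₂ (0<-⇔ a b) a<b , proj₂ (-<1⇔ a b) b<a+1
       ; (inj₂ b+1<a) → contradiction (ℚₚ.<-trans b+1<a (≤⇒<+1 a≤b)) (ℚₚ.<-irrefl refl) })
  ... | no a≰b =
    (λ { (_ , <1) → inj₂ (proj₁ (-+2<1⇔ a b) <1) }) ,
    (λ { (inj₁ (a<b , _)) → contradiction (ℚₚ.<⇒≤ a<b) a≰b
       ; (inj₂ b+1<a) → proj₂ (0<-+2⇔ a b) (ℚₚ.<-≤-trans a<2 2≤b+2) , proj₂ (-+2<1⇔ a b) b+1<a })
    where
    2≤b+2 : 2ℚ ≤ b + 2ℚ
    2≤b+2 = subst (_≤ b + 2ℚ) (ℚₚ.+-identityˡ 2ℚ) (ℚₚ.+-monoˡ-≤ 2ℚ 0≤b)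

  -- Cutting the circle at angle 0 splits the right half into two intervals of [0,2).
  data Zone (a : ℚ) : Set where
    right₁ : a < ½ → Zone a
    left   : ½ < a → a < 3/2 → Zone a
    right₂ : 3/2 < a → Zone a

  half : ∀ {a} → Zone a → Fin 2
  half (right₁ _) = zero
  half (left _ _) = suc zero
  half (right₂ _) = zero

  -- Rotating the left half by π turns the order of S(2)* into the order of angles;
  -- θ is the rotated angle, taken in (3/2, 5/2).
  θ : ∀ {a} → Zone a → ℚ
  θ {a} (right₁ _) = a + 2ℚ
  θ {a} (left _ _) = a + 1ℚ
  θ {a} (right₂ _) = a

  -- Lets `side` and `pos` of a concrete point be found from any proof of its zone, without
  -- evaluating `zone`.
  zone-unique : ∀ {a} (z z′ : Zone a) → half z ≡ half z′ × θ z ≡ θ z′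
  zone-unique (right₁ _)    (right₁ _)    = refl , refl
  zone-unique (left _ _)    (left _ _)    = refl , refl
  zone-unique (right₂ _)    (right₂ _)    = refl , refl
  zone-unique (right₁ a<½)  (left ½<a _)  = contradiction ½<a (ℚₚ.<-asym a<½)
  zone-unique (left ½<a _)  (right₁ a<½)  = contradiction ½<a (ℚₚ.<-asym a<½)
  zone-unique (left _ a<)   (right₂ <a)   = contradiction <a (ℚₚ.<-asym a<)
  zone-unique (right₂ <a)   (left _ a<)   = contradiction <a (ℚₚ.<-asym a<)
  zone-unique (right₁ a<½)  (right₂ <a)   =
    contradiction (ℚₚ.<-trans a<½ (from-yes (½ <? 3/2))) (ℚₚ.<-asym <a)
  zone-unique (right₂ <a)   (right₁ a<½)  =
    contradiction (ℚₚ.<-trans a<½ (from-yes (½ <? 3/2))) (ℚₚ.<-asym <a)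

  inD? : ∀ q → Dec (InD q)
  inD? q = (0ℚ ≤? q) ×-dec (q <? 2ℚ) ×-dec (2 ∣? ∣ ℚ.numerator q ∣) ×-dec ¬? (2 ∣? ℚ.denominatorℕ q)

  -- The field `inD` is irrelevant; a usable proof is recomputed from decidability.
  inD′ : ∀ x → InD (angle x)
  inD′ (pt a d) = recompute (inD? a) d

  pt-≡ : ∀ {x y} → angle x ≡ angle y → x ≡ y
  pt-≡ {pt _ _} {pt _ _} refl = refl

  parity : ∀ x → EvenOverOdd (angle x)
  parity x = proj₂ (proj₂ (inD′ x))

  zone : ∀ x → Zone (angle x)
  zone x with ℚₚ.<-cmp (angle x) ½ | ℚₚ.<-cmp (angle x) 3/2
  ... | tri< a<½ _ _ | _ = right₁ a<½
  ... | tri≈ _ eq _  | _ =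
    contradiction (subst (λ q → 2 ∣ ℚ.denominatorℕ q) (sym eq) (divides 1 refl)) (proj₂ (parity x))
  ... | tri> _ _ ½<a | tri< a<3/2 _ _ = left ½<a a<3/2
  ... | tri> _ _ _   | tri≈ _ eq _ =
    contradiction (subst (λ q → 2 ∣ ℚ.denominatorℕ q) (sym eq) (divides 1 refl)) (proj₂ (parity x))
  ... | tri> _ _ _   | tri> _ _ 3/2<a = right₂ 3/2<a

  side : DPt → Fin 2
  side x = half (zone x)

  pos : DPt → ℚ
  pos x = θ (zone x)

  0≤angle : ∀ x → 0ℚ ≤ angle x
  0≤angle x = proj₁ (inD′ x)

  angle<2 : ∀ x → angle x < 2ℚ
  angle<2 x = proj₁ (proj₂ (inD′ x))

  2≤angle+2 : ∀ x → 2ℚ ≤ angle x + 2ℚ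
  2≤angle+2 x = subst (_≤ angle x + 2ℚ) (ℚₚ.+-identityˡ 2ℚ) (ℚₚ.+-monoˡ-≤ 2ℚ (0≤angle x))

  E⇔precedes : ∀ x y → S2E x y ⇔ Precedes (angle x) (angle y)
  E⇔precedes x y = ccw-precedes (angle x) (angle y) (0≤angle y) (angle<2 x)

  -- Points of one half are turned by the same angle modulo 2, and the positions fill an interval of
  -- length 1, so the larger position is less than a half turn ahead.
  same-side : ∀ x y → side x ≡ side y → pos x < pos y → Precedes (angle x) (angle y)
  same-side x y eq lt with zone x | zone y
  ... | right₁ a<½   | right₁ b<½   = inj₁ (proj₂ (shift 2ℚ refl refl) lt ,
          ℚₚ.<-≤-trans (ℚₚ.<-trans b<½ (from-yes (½ <? 1ℚ)))
            (subst (_≤ angle x + 1ℚ) (ℚₚ.+-identityˡ 1ℚ) (ℚₚ.+-monoˡ-≤ 1ℚ (0≤angle x))))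
  ... | right₁ _     | right₂ _     = contradiction (ℚₚ.<-trans lt (angle<2 y)) λ a+2<2 →
          ℚₚ.<-irrefl refl (ℚₚ.<-≤-trans a+2<2 (2≤angle+2 x))
  ... | left ½<a _   | left _ b<3/2 = inj₁ (proj₂ (shift 1ℚ refl refl) lt ,
          ℚₚ.<-trans b<3/2 (ℚₚ.+-monoˡ-< 1ℚ ½<a))
  ... | right₂ 3/2<a | right₁ b<½   = inj₂ (ℚₚ.<-trans (ℚₚ.+-monoˡ-< 1ℚ b<½) 3/2<a)
  ... | right₂ 3/2<a | right₂ _     = inj₁ (lt ,
          ℚₚ.<-trans (angle<2 y) (ℚₚ.<-trans (from-yes (2ℚ <? 3/2 + 1ℚ)) (ℚₚ.+-monoˡ-< 1ℚ 3/2<a)))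

  -- Turning just one of two points by π reverses E between them.
  opposite-side : ∀ x y → side x ≢ side y → pos y < pos x → Precedes (angle x) (angle y)
  opposite-side x y neq lt with zone x | zone y
  ... | right₁ _     | right₁ _     = contradiction refl neq
  ... | right₁ _     | right₂ _     = contradiction refl neq
  ... | right₂ _     | right₁ _     = contradiction refl neq
  ... | right₂ _     | right₂ _     = contradiction refl neq
  ... | left _ _     | left _ _     = contradiction refl neq
  ... | right₁ a<½   | left ½<b _   = inj₁ (ℚₚ.<-trans a<½ ½<b , proj₁ (+1<+2⇔ (angle y) (angle x)) lt)
  ... | right₂ _     | left _ _     = inj₂ lt
  ... | left _ _     | right₁ _     = inj₂ (proj₁ (+2<+1⇔ (angle y) (angle x)) lt)
  ... | left _ a<3/2 | right₂ 3/2<b = inj₁ (ℚₚ.<-trans a<3/2 3/2<b , lt)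

  not-antipodal : ∀ x y → angle y ≢ angle x + 1ℚ
  not-antipodal x y = evenOverOdd-+1 {angle x} {angle y} (parity x) (parity y)

  -- Equal positions in different halves would make the points antipodal.
  pos-injective : ∀ x y → pos x ≡ pos y → x ≡ y
  pos-injective x y eq with zone x | zone y
  ... | right₁ _ | right₁ _ = pt-≡ (+-cancelʳ 2ℚ _ _ eq)
  ... | left _ _ | left _ _ = pt-≡ (+-cancelʳ 1ℚ _ _ eq)
  ... | right₂ _ | right₂ _ = pt-≡ eq
  ... | right₁ _ | right₂ _ =
    contradiction (ℚₚ.≤-<-trans (2≤angle+2 x) (subst (_< 2ℚ) (sym eq) (angle<2 y))) (ℚₚ.<-irrefl refl)
  ... | right₂ _ | right₁ _ =
    contradiction (ℚₚ.≤-<-trans (2≤angle+2 y) (subst (_< 2ℚ) eq (angle<2 x))) (ℚₚ.<-irrefl refl)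
  ... | right₁ _ | left _ _ = contradiction (+1≡+2 (angle y) (angle x) (sym eq)) (not-antipodal x y)
  ... | left _ _ | right₁ _ = contradiction (+1≡+2 (angle x) (angle y) eq) (not-antipodal y x)
  ... | left _ _ | right₂ _ = contradiction (sym eq) (not-antipodal x y)
  ... | right₂ _ | left _ _ = contradiction eq (not-antipodal y x)

  E-asym : ∀ x y → S2E x y → ¬ S2E y x
  E-asym x y xy yx = precedes-asym (proj₁ (E⇔precedes x y) xy) (proj₁ (E⇔precedes y x) yx)

  E-irr : ∀ x → ¬ S2E x x
  E-irr x xx = E-asym x x xx xx

  E-same : ∀ x y → side x ≡ side y → pos x < pos y → S2E x y
  E-same x y eq lt = proj₂ (E⇔precedes x y) (same-side x y eq lt)

  E-opposite : ∀ x y → side x ≢ side y → pos x < pos y → S2E y x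
  E-opposite x y neq lt = proj₂ (E⇔precedes y x) (opposite-side y x (neq ∘ sym) lt)

  half-side : ∀ i x → S2Half i x ⇔ (side x ≡ i)
  half-side zero x with zone x
  ... | right₁ a<½       = (λ _ → refl) , λ _ → inj₁ a<½
  ... | right₂ 3/2<a     = (λ _ → refl) , λ _ → inj₂ 3/2<a
  ... | left ½<a a<3/2   = (λ { (inj₁ a<½) → contradiction ½<a (ℚₚ.<-asym a<½)
                              ; (inj₂ 3/2<a) → contradiction 3/2<a (ℚₚ.<-asym a<3/2) }) , λ ()
  half-side (suc zero) x with zone x
  ... | right₁ a<½       = (λ { (½<a , _) → contradiction ½<a (ℚₚ.<-asym a<½) }) , λ ()
  ... | right₂ 3/2<a     = (λ { (_ , a<3/2) → contradiction 3/2<a (ℚₚ.<-asym a<3/2) }) , λ ()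
  ... | left ½<a a<3/2   = (λ _ → refl) , λ _ → ½<a , a<3/2

  sameHalf⇔ : ∀ x y → SameHalf x y ⇔ (side x ≡ side y)
  sameHalf⇔ x y = to , from (side x) refl
    where
    to : SameHalf x y → side x ≡ side y
    to (inj₁ (rx , ry)) = trans (proj₁ (half-side zero x) rx) (sym (proj₁ (half-side zero y) ry))
    to (inj₂ (lx , ly)) = trans (proj₁ (half-side (suc zero) x) lx) (sym (proj₁ (half-side (suc zero) y) ly))
    from : ∀ i → side x ≡ i → side x ≡ side y → SameHalf x y
    from zero       eq eq′ = inj₁ (proj₂ (half-side zero x) eq , proj₂ (half-side zero y) (trans (sym eq′) eq))
    from (suc zero) eq eq′ =
      inj₂ (proj₂ (half-side (suc zero) x) eq , proj₂ (half-side (suc zero) y) (trans (sym eq′) eq))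

  diffHalf⇔ : ∀ x y → DiffHalf x y ⇔ (side x ≢ side y)
  diffHalf⇔ x y = to , from (side x) (side y) refl refl
    where
    to : DiffHalf x y → side x ≢ side y
    to (inj₁ (rx , ly)) eq =
      contradiction (trans (sym (proj₁ (half-side zero x) rx)) (trans eq (proj₁ (half-side (suc zero) y) ly))) λ ()
    to (inj₂ (lx , ry)) eq =
      contradiction (trans (sym (proj₁ (half-side (suc zero) x) lx)) (trans eq (proj₁ (half-side zero y) ry))) λ ()
    from : ∀ i j → side x ≡ i → side y ≡ j → side x ≢ side y → DiffHalf x y
    from zero       (suc zero) eq eq′ _   = inj₁ (proj₂ (half-side zero x) eq , proj₂ (half-side (suc zero) y) eq′)
    from (suc zero) zero       eq eq′ _   = inj₂ (proj₂ (half-side (suc zero) x) eq , proj₂ (half-side zero y) eq′)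
    from zero       zero       eq eq′ neq = contradiction (trans eq (sym eq′)) neq
    from (suc zero) (suc zero) eq eq′ neq = contradiction (trans eq (sym eq′)) neq

  -- Transitivity, hidden by the definition of the order by cases, is inherited from ℚ through this
  -- equivalence.
  Lt⇔pos : ∀ x y → Lt S2Star x y ⇔ (pos x < pos y)
  Lt⇔pos x y = to , from
    where
    to : Lt S2Star x y → pos x < pos y
    to lt with ℚₚ.<-cmp (pos x) (pos y) | lt
    ... | tri< x<y _ _ | _ = x<y
    ... | tri≈ _ eq _  | inj₁ (_ , xy) =
      contradiction (subst (S2E x) (sym (pos-injective x y eq)) xy) (E-irr x)
    ... | tri≈ _ eq _  | inj₂ (_ , yx) =
      contradiction (subst (λ z → S2E z x) (sym (pos-injective x y eq)) yx) (E-irr x)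
    ... | tri> _ _ y<x | inj₁ (same , xy) =
      contradiction (E-same y x (sym (proj₁ (sameHalf⇔ x y) same)) y<x) (E-asym x y xy)
    ... | tri> _ _ y<x | inj₂ (diff , yx) =
      contradiction (E-opposite y x (proj₁ (diffHalf⇔ x y) diff ∘ sym) y<x) (E-asym y x yx)
    from : pos x < pos y → Lt S2Star x y
    from x<y with side x Finₚ.≟ side y
    ... | yes eq = inj₁ (proj₂ (sameHalf⇔ x y) eq , E-same x y eq x<y)
    ... | no neq = inj₂ (proj₂ (diffHalf⇔ x y) neq , E-opposite x y neq x<y)

  E⇔side : ∀ x y → Lt S2Star x y → S2E x y ⇔ (side x ≡ side y)
  E⇔side x y lt = to , λ eq → E-same x y eq x<y
    where
    x<y = proj₁ (Lt⇔pos x y) lt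
    to : S2E x y → side x ≡ side y
    to xy with side x Finₚ.≟ side y
    ... | yes eq = eq
    ... | no neq = contradiction xy (E-asym y x (E-opposite x y neq x<y))

  S2-tournament : IsOrderedTournament S2Star
  S2-tournament = E-irr , E-asym , E-total ,
    (λ x lt → ℚₚ.<-irrefl refl (proj₁ (Lt⇔pos x x) lt)) ,
    (λ x y z xy yz → proj₂ (Lt⇔pos x z) (ℚₚ.<-trans (proj₁ (Lt⇔pos x y) xy) (proj₁ (Lt⇔pos y z) yz))) ,
    Lt-total
    where
    pos-total : ∀ x y → x ≢ y → pos x < pos y ⊎ pos y < pos x
    pos-total x y x≢y with ℚₚ.<-cmp (pos x) (pos y)
    ... | tri< lt _ _ = inj₁ lt
    ... | tri≈ _ eq _ = contradiction (pos-injective x y eq) x≢y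
    ... | tri> _ _ gt = inj₂ gt
    Lt-total : ∀ x y → x ≢ y → Lt S2Star x y ⊎ Lt S2Star y x
    Lt-total x y x≢y = Sum.map (proj₂ (Lt⇔pos x y)) (proj₂ (Lt⇔pos y x)) (pos-total x y x≢y)
    E-total : ∀ x y → x ≢ y → S2E x y ⊎ S2E y x
    E-total x y x≢y with side x Finₚ.≟ side y | pos-total x y x≢y
    ... | yes eq | inj₁ lt = inj₁ (E-same x y eq lt)
    ... | yes eq | inj₂ gt = inj₂ (E-same y x (sym eq) gt)
    ... | no neq | inj₁ lt = inj₂ (E-opposite x y neq lt)
    ... | no neq | inj₂ gt = inj₁ (E-opposite y x (neq ∘ sym) gt)

  -- With d = 4c + 1, the points of the right half are put at the angles 2x/d and those of the
  -- left half opposite to (2x+1)/d; the parity of d makes all of them points of D.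
  module _ (c : ℕ) where
    private
      d : ℕ
      -- Large enough that the offsets (2x + l)/d with x < c and l < 2 stay below ½, and odd.
      d = suc (4 ℕ.* c)

      2∤d : ¬ 2 ∣ d
      2∤d 2∣d = contradiction (∣1⇒≡1 (∣m+n∣m⇒∣n (subst (2 ∣_) (ℕₚ.+-comm 1 (4 ℕ.* c)) 2∣d)
        (∣m⇒∣m*n c (divides 2 refl)))) λ ()

      place-bound : ∀ {x} l → x ℕ.< c → l ℕ.< 2 → (2 ℕ.* x ℕ.+ l) ℕ.* 2 ℕ.< d
      place-bound {x} l x<c (ℕ.s≤s l≤1) = begin-strict
        (2 ℕ.* x ℕ.+ l) ℕ.* 2     ≤⟨ ℕₚ.*-monoˡ-≤ 2 (ℕₚ.+-monoʳ-≤ (2 ℕ.* x) (ℕₚ.m≤n⇒m≤1+n l≤1)) ⟩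
        (2 ℕ.* x ℕ.+ 2) ℕ.* 2     ≡⟨ solve 1 (λ x → (con 2 :* x :+ con 2) :* con 2 := con 4 :* (con 1 :+ x)) refl x ⟩
        4 ℕ.* suc x               ≤⟨ ℕₚ.*-monoʳ-≤ 4 x<c ⟩
        4 ℕ.* c                   <⟨ ℕₚ.n<1+n _ ⟩
        d                         ∎
        where
        open ℕₚ.≤-Reasoning
        open ℕSolver.+-*-Solver

    -- A half turn adds the odd number d to the numerator, so the left offset 2x + 1 is odd to make
    -- the sum even. After rotation both kinds sit at 2 + (2x + l)/d and interleave; the `+ 0` keeps
    -- this common shape.
    rightAngle leftAngle : Fin c → ℚ
    rightAngle x = + (2 ℕ.* toℕ x ℕ.+ 0) ℚ./ d
    leftAngle  x = + (d ℕ.+ (2 ℕ.* toℕ x ℕ.+ 1)) ℚ./ d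

    right-zone : ∀ x → rightAngle x < ½
    right-zone x = fraction-< (2 ℕ.* toℕ x ℕ.+ 0) d 1 2
      (subst ((2 ℕ.* toℕ x ℕ.+ 0) ℕ.* 2 ℕ.<_) (sym (ℕₚ.*-identityˡ d))
      (place-bound 0 (Finₚ.toℕ<n x) (ℕ.s≤s ℕ.z≤n)))

    left-zone : ∀ x → ½ < leftAngle x × leftAngle x < 3/2
    left-zone x = fraction-< 1 2 (d ℕ.+ m) d low , fraction-< (d ℕ.+ m) d 3 2 high
      where
      m = 2 ℕ.* toℕ x ℕ.+ 1
      open ℕₚ.≤-Reasoning
      low : 1 ℕ.* d ℕ.< (d ℕ.+ m) ℕ.* 2
      low = begin-strict
        1 ℕ.* d          ≡⟨ ℕₚ.*-identityˡ d ⟩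
        d                <⟨ ℕₚ.m<m*n d 2 (ℕ.s≤s (ℕ.s≤s ℕ.z≤n)) ⟩
        d ℕ.* 2          ≤⟨ ℕₚ.*-monoˡ-≤ 2 (ℕₚ.m≤m+n d m) ⟩
        (d ℕ.+ m) ℕ.* 2  ∎
      high : (d ℕ.+ m) ℕ.* 2 ℕ.< 3 ℕ.* d
      high = begin-strict
        (d ℕ.+ m) ℕ.* 2       ≡⟨ ℕₚ.*-distribʳ-+ 2 d m ⟩
        d ℕ.* 2 ℕ.+ m ℕ.* 2   <⟨ ℕₚ.+-monoʳ-< (d ℕ.* 2) (place-bound 1 (Finₚ.toℕ<n x) (ℕ.s≤s (ℕ.s≤s ℕ.z≤n))) ⟩
        d ℕ.* 2 ℕ.+ d         ≡⟨ solve 1 (λ d → d :* con 2 :+ d := con 3 :* d) refl d ⟩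
        3 ℕ.* d               ∎
        where open ℕSolver.+-*-Solver

    rightPt leftPt : Fin c → DPt
    rightPt x = pt (rightAngle x)
      ( ℚₚ.nonNegative⁻¹ (rightAngle x) {{ℚₚ.normalize-nonNeg (2 ℕ.* toℕ x ℕ.+ 0) d}}
      , ℚₚ.<-trans (right-zone x) (from-yes (½ <? 2ℚ))
      , evenOverOdd-fraction (2 ℕ.* toℕ x ℕ.+ 0) d
          (divides (toℕ x) (trans (ℕₚ.+-identityʳ _) (ℕₚ.*-comm 2 (toℕ x)))) 2∤d )
    leftPt x = pt (leftAngle x)
      ( ℚₚ.nonNegative⁻¹ (leftAngle x) {{ℚₚ.normalize-nonNeg (d ℕ.+ (2 ℕ.* toℕ x ℕ.+ 1)) d}}
      , ℚₚ.<-trans (proj₂ (left-zone x)) (from-yes (3/2 <? 2ℚ))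
      , evenOverOdd-fraction (d ℕ.+ (2 ℕ.* toℕ x ℕ.+ 1)) d
          (divides (suc (2 ℕ.* c ℕ.+ toℕ x)) (solve 2 (λ c x →
            (con 1 :+ con 4 :* c) :+ (con 2 :* x :+ con 1) := (con 1 :+ (con 2 :* c :+ x)) :* con 2)
            refl c (toℕ x))) 2∤d )
      where open ℕSolver.+-*-Solver

    place : Fin 2 → Fin c → DPt
    place zero       = rightPt
    place (suc zero) = leftPt

    side-place : ∀ l x → side (place l x) ≡ l
    side-place zero       x = proj₁ (zone-unique (zone (rightPt x)) (right₁ (right-zone x)))
    side-place (suc zero) x = proj₁ (zone-unique (zone (leftPt x)) (uncurry left (left-zone x)))

    pos-place : ∀ l x → pos (place l x) ≡ (+ (2 ℕ.* toℕ x ℕ.+ toℕ l) ℚ./ d) + 2ℚ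
    pos-place zero       x = proj₂ (zone-unique (zone (rightPt x)) (right₁ (right-zone x)))
    pos-place (suc zero) x = trans (proj₂ (zone-unique (zone (leftPt x)) (uncurry left (left-zone x))))
      (trans (cong (_+ 1ℚ) (fraction-suc (2 ℕ.* toℕ x ℕ.+ 1) d)) (ℚₚ.+-assoc (+ (2 ℕ.* toℕ x ℕ.+ 1) ℚ./ d) 1ℚ 1ℚ))

    pos-place-mono : ∀ l l′ {x x′} → x Fin.< x′ → pos (place l x) < pos (place l′ x′)
    pos-place-mono l l′ {x} {x′} x<x′ = subst₂ _<_ (sym (pos-place l x)) (sym (pos-place l′ x′))
      (ℚₚ.+-monoˡ-< 2ℚ (fraction-< (2 ℕ.* toℕ x ℕ.+ toℕ l) d (2 ℕ.* toℕ x′ ℕ.+ toℕ l′) d (ℕₚ.*-monoˡ-< d (begin-strict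
        2 ℕ.* toℕ x ℕ.+ toℕ l     <⟨ ℕₚ.+-monoʳ-< (2 ℕ.* toℕ x) (Finₚ.toℕ<n l) ⟩
        2 ℕ.* toℕ x ℕ.+ 2         ≡⟨ solve 1 (λ x → con 2 :* x :+ con 2 := con 2 :* (con 1 :+ x)) refl (toℕ x) ⟩
        2 ℕ.* suc (toℕ x)         ≤⟨ ℕₚ.*-monoʳ-≤ 2 x<x′ ⟩
        2 ℕ.* toℕ x′              ≤⟨ ℕₚ.m≤m+n _ (toℕ l′) ⟩
        2 ℕ.* toℕ x′ ℕ.+ toℕ l′   ∎))))
      where
      open ℕₚ.≤-Reasoning
      open ℕSolver.+-*-Solver

  labelled : LabelledTournament S2Star
  labelled = record
    { _≟_        = λ x y → map′ pt-≡ (cong angle) (angle x ℚₚ.≟ angle y)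
    ; tournament = S2-tournament
    ; ℓ          = 2
    ; label      = side
    ; label⇒U    = λ i {s} {t} eq u → proj₂ (half-side i t) (trans (sym eq) (proj₁ (half-side i s) u))
    ; U⇒label    = λ s t same → sym (proj₁ (half-side (side s) t)
                     (proj₁ (same (side s)) (proj₂ (half-side (side s) s) refl)))
    -- For increasing pairs E means equality of labels, on both sides of the equivalence.
    ; realise    = λ {c} e → place c , side-place c , Lt-place c , λ {x} {x′} x<x′ {s} {t} s<t _ →
        ⇔-trans (E⇔side s t s<t) (⇔-trans
          (⇔-cong _≡_ (sym (side-place c (side s) x)) (sym (side-place c (side t) x′)))
          (⇔-sym (E⇔side (place c (side s) x) (place c (side t) x′) (Lt-place c (side s) (side t) x<x′))))
    }
    where
    Lt-place : ∀ c l l′ {x x′ : Fin c} → x Fin.< x′ → Lt S2Star (place c l x) (place c l′ x′)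
    Lt-place c l l′ x<x′ = proj₂ (Lt⇔pos _ _) (pos-place-mono c l l′ x<x′)

-- The five homogeneous tournaments.

open import Data.Fin using (_≟_)
open import Data.Product using (proj₁)
open import Relation.Nullary using (yes)
open import Relation.Binary.PropositionalEquality using (refl; sym)
open LabelledTournaments using (module Transfer)
open RigidStructures using (In-rigid)

theorem6p2 : ∀ (n : ℕ) → n ≥ 1 → ∀ (I : Set) (T : Str I) →
    HomTournamentExpansion I T → RamseyProperty (Age (In n T))
theorem6p2 n _ _ _ isI1        = In-rigid n I1Star (λ _ _ → yes refl) (λ _ _ _ → refl)
theorem6p2 n _ _ _ isC3        = In-rigid n C3Star _≟_ (λ x y same → sym (proj₁ (same x) refl))
theorem6p2 n _ _ _ isQ         = Transfer.ramseyProperty RationalOrder.labelled n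
theorem6p2 n _ _ _ isS2        = Transfer.ramseyProperty DenseLocalOrder.labelled n
theorem6p2 n _ _ _ (isTω M Mω) = Transfer.ramseyProperty (GenericTournament.labelled M Mω) n
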